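{- Let $n\ge 2$, let $\varepsilon\in\{\pm1\}^n$, let $T$ be a mixed cobinary tree with $\varepsilon(T)=\varepsilon$ and with internal edges numbered $\ell_1,\dots,\ell_{n-1}$, and let $1\le k\le n-1$. Let $T^\ast=\mu_k(T)$ be the mutation of $T$ in the $k$-direction. Then the exchange matrix of $T^\ast$ equals the (Fomin–Zelevinsky) mutation in the $k$-direction of the exchange matrix of $T$: $$\tilde B(\mu_k(T))=\mu_k(\tilde B(T)).$$
   Context: A mixed cobinary tree (MCT) with $n$ internal nodes is a finite tree $T$ linearly embedded in the $xy$-plane (vertices are points, edges are straight segments meeting only in common endpoints) such that: (1) $T$ has no horizontal edges. (2) The internal nodes (the vertices which are not leaves, a leaf being a vertex of degree one) have distinct $x$-coordinates, which are $1,2,\dots,n$; denote by $t_i$ the internal node with $x$-coordinate $i$. A neighbour (internal or leaf) of an internal node lying higher is called a parent of it, one lying lower a child of it. (3) Each internal node is either of positive type (a $\Lambda$-node), with two children and one parent, or of negative type (a V-node), with one child and two parents. (4) If $(x,y)$ is a positive node, then the vertical wall $\{(x,z): z<y\}$ is disjoint from $T$ and separates the two children of the node (one is to its left, one to its right). (5) If $(x,y)$ is a negative node, then the vertical wall $\{(x,z): z>y\}$ is disjoint from $T$ and separates the two parents of the node. The sign vector is $\varepsilon(T)=(\varepsilon_1,\dots,\varepsilon_n)$ with $\varepsilon_i=1$ if $t_i$ is a $\Lambda$-node and $\varepsilon_i=-1$ if $t_i$ is a V-node. The bottom-to-top partial order on the internal nodes is the one generated by "each child is below its parent". Two MCTs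 with the same sign vector are isomorphic if their underlying trees are isomorphic by an isomorphism under which corresponding internal nodes have the same left-to-right total order (i.e. $t_i\mapsto t_i$) and the same bottom-to-top partial order. MCTs are considered up to isomorphism. The $n-1$ internal edges of $T$ (edges joining two internal nodes) are numbered $\ell_1,\dots,\ell_{n-1}$; $\ell_i$ joins $t_{p_i}$ to $t_{q_i}$ with $p_i<q_i$, and $\mathrm{sgn}(\ell_i)=\pm1$ is the sign of its slope. Put $R(T)=\{x\in\mathbb R^n: \mathrm{sgn}(\ell_i)(x_{q_i}-x_{p_i})>0 \text{ for } 1\le i\le n-1\}$ and let $\overline R(T)$ be its closure. The $c$-vector of $\ell_i$ is $c_i(T)=\mathrm{sgn}(\ell_i)\sum_{p_i\le j<q_i}e_j\in\mathbb Z^{n-1}$, and $C(T)$ is the $(n-1)\times(n-1)$ matrix with columns $c_1(T),\dots,c_{n-1}(T)$. Mutation of trees: $\mu_k(T)$ is the unique (up to isomorphism) MCT $T^\ast$ with sign vector $\varepsilon$ whose region is reached from $R(T)$ by crossing the wall of $\overline R(T)$ given by $x_{p_k}=x_{q_k}$, i.e. such that $\overline R(T)\cap\overline R(T^\ast)$ is the face $\overline R(T)\cap\{x_{p_k}=x_{q_k}\}$ of $\overline R(T)$. The internal edges of $T^\ast$ are numbered (in the unique possible way) so that $c_k(T^\ast)=-c_k(T)$ and $c_j(T^\ast)\in\{c_j(T),\,c_j(T)+c_k(T)\}$ for $j\ne k$. The quiver $Q_\varepsilon$ has vertices $1,\dots,n-1$ and, for $1\le i\le n-2$, one arrow between $i$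 and $i+1$, which is $i+1\to i$ if $\varepsilon_{i+1}=1$ and $i\to i+1$ if $\varepsilon_{i+1}=-1$. Its Euler matrix $E_\varepsilon$ is the $(n-1)\times(n-1)$ matrix with $1$'s on the diagonal, $(i,j)$ entry $-1$ whenever there is an arrow $i\to j$, and all other entries $0$. Put $X_\varepsilon=E_\varepsilon-E_\varepsilon^t$. The exchange matrix of $T$ is the $2(n-1)\times(n-1)$ matrix $$\tilde B(T)=\begin{bmatrix}C^tX_\varepsilon C\\ C\end{bmatrix},\qquad C=C(T).$$ Matrix mutation: for a $2m\times m$ integer matrix $\tilde B=(b_{ij})$ and $1\le k\le m$, $\mu_k(\tilde B)=(b'_{ij})$ where (1) $b'_{ij}=-b_{ij}$ if $i=k$ or $j=k$; (2) $b'_{ij}=b_{ij}+b_{ik}|b_{kj}|$ if $i,j\ne k$ and $b_{ik},b_{kj}$ have the same sign (both positive or both negative); (3) $b'_{ij}=b_{ij}$ otherwise. -}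

module Defs where

open import Level using (_⊔_; 0ℓ) renaming (suc to lsuc)
open import Algebra.Bundles using (CommutativeRing)
import Algebra.Definitions.RawMonoid as RawMonoidOps
open import Data.Bool.Base using (if_then_else_)
open import Data.Empty using (⊥)
open import Data.Fin.Base as Fin using (Fin; zero; suc; toℕ; fromℕ; inject₁; inject≤; _↑ˡ_)
import Data.Fin.Properties as Fin
open import Data.Integer.Base as ℤ using (ℤ; 0ℤ; 1ℤ; -1ℤ; ∣_∣; _◃_)
import Data.Integer.Properties as ℤ
open import Data.Nat.Base as ℕ using (ℕ; pred)
import Data.Nat.Properties as ℕ
open import Data.Product.Base using (∃; ∃₂; _×_; _,_)
open import Data.Product using (∃!)
open import Data.Sign.Base as Sign using (Sign)
import Data.Sign.Properties as Sign
open import Data.Sum.Base using (_⊎_; [_,_]′)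
open import Data.Vec.Base as Vec using (Vec)
open import Data.Vec.Functional using (Vector; _++_)
open import Function.Base using (const)
open import Function.Bundles using (_⇔_)
open import Function.Definitions using (Injective)
open import Relation.Binary.Core using (Rel)
open import Relation.Binary.Definitions using (Decidable)
open import Relation.Binary.Construct.Closure.ReflexiveTransitive using (Star)
import Relation.Binary.Construct.StrictToNonStrict as StrictToNonStrict
open import Relation.Binary.PropositionalEquality.Core using (_≡_; _≢_)
open import Relation.Binary.Structures using (IsStrictTotalOrder)
open import Relation.Nullary using (¬_; Dec; does)
open import Relation.Nullary.Decidable using (_×-dec_; _⊎-dec_)

import Algebra.Properties.Semiring.Sum ℤ.+-*-semiring as Sumℤ

------------------------------------------------------------------------
-- Ordered fields

-- The library has no real numbers.  The plane is taken over an arbitrary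
-- totally ordered field, of which ℝ (classically) and ℚ are instances.
record OrderedField c ℓ₁ ℓ₂ : Set (lsuc (c ⊔ ℓ₁ ⊔ ℓ₂)) where
  infix 4 _<_
  field
    commutativeRing : CommutativeRing c ℓ₁
  open CommutativeRing commutativeRing public
  field
    _<_                : Rel Carrier ℓ₂
    isStrictTotalOrder : IsStrictTotalOrder _≈_ _<_
    0<1                : 0# < 1#
    +-monoˡ-<          : ∀ z {x y} → x < y → x + z < y + z
    *-pos              : ∀ {x y} → 0# < x → 0# < y → 0# < x * y
    inverse            : ∀ x → ¬ (x ≈ 0#) → ∃ λ y → x * y ≈ 1#

  open IsStrictTotalOrder isStrictTotalOrder public using (compare; _<?_)
  open StrictToNonStrict _≈_ _<_ public using (_≤_)

  fromNat : ℕ → Carrier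
  fromNat k = RawMonoidOps._×_ +-rawMonoid k 1#

  infixr 8 _·_
  _·_ : Sign → Carrier → Carrier
  Sign.+ · a = a
  Sign.- · a = - a

------------------------------------------------------------------------
-- Finite trees

record FiniteTree : Set₁ where
  field
    size : ℕ

  Vertex : Set
  Vertex = Fin size

  field
    Adj         : Rel Vertex 0ℓ
    adj?        : Decidable Adj
    adj-sym     : ∀ {u v} → Adj u v → Adj v u
    adj-irrefl  : ∀ {v} → ¬ Adj v v
    connected   : ∀ u v → Star Adj u v
    -- no cycle v₀ — v₁ — ⋯ — v_{m+2} — v₀ through m + 3 distinct vertices
    acyclic     : ∀ m (f : Fin (3 ℕ.+ m) → Vertex) → Injective _≡_ _≡_ f →
                  (∀ i → Adj (f (inject₁ i)) (f (suc i))) →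
                  Adj (f (fromℕ (2 ℕ.+ m))) (f zero) → ⊥

  Leaf : Vertex → Set
  Leaf v = ∃! _≡_ (Adj v)

  Internal : Vertex → Set
  Internal v = ¬ Leaf v

∃!₂ : ∀ {a p} {A : Set a} → (A → Set p) → Set (a ⊔ p)
∃!₂ P = ∃₂ λ a b → a ≢ b × P a × P b × (∀ {c} → P c → c ≡ a ⊎ c ≡ b)

------------------------------------------------------------------------
-- Trees linearly embedded in the plane

record PlaneTree {c ℓ₁ ℓ₂} (F : OrderedField c ℓ₁ ℓ₂) : Set (lsuc 0ℓ ⊔ c ⊔ ℓ₁ ⊔ ℓ₂) where
  open OrderedField F

  field
    tree : FiniteTree
  open FiniteTree tree public

  field
    x y : Vertex → Carrier

  OnEdge : Vertex → Vertex → Carrier → Carrier → Set (c ⊔ ℓ₁ ⊔ ℓ₂)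
  OnEdge u v a b = ∃ λ s → 0# ≤ s × s ≤ 1# ×
                     a ≈ (1# - s) * x u + s * x v ×
                     b ≈ (1# - s) * y u + s * y v

  field
    vertices-distinct : ∀ {u v} → x u ≈ x v → y u ≈ y v → u ≡ v
    edges-meet        : ∀ {u v u′ v′} → Adj u v → Adj u′ v′ →
                        ¬ (u ≡ u′ × v ≡ v′) → ¬ (u ≡ v′ × v ≡ u′) →
                        ∀ {a b} → OnEdge u v a b → OnEdge u′ v′ a b →
                        ∃ λ w → (w ≡ u ⊎ w ≡ v) × (w ≡ u′ ⊎ w ≡ v′) × a ≈ x w × b ≈ y w

  OnTree : Carrier → Carrier → Set (c ⊔ ℓ₁ ⊔ ℓ₂)
  OnTree a b = ∃₂ λ u v → Adj u v × OnEdge u v a b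

  Parent : Vertex → Vertex → Set ℓ₂
  Parent v u = Adj v u × y v < y u

  Child : Vertex → Vertex → Set ℓ₂
  Child v u = Adj v u × y u < y v

  Λ-node : Vertex → Set ℓ₂
  Λ-node v = ∃!₂ (Child v) × ∃! _≡_ (Parent v)

  V-node : Vertex → Set ℓ₂
  V-node v = ∃! _≡_ (Child v) × ∃!₂ (Parent v)

  -- the vertical line through v has one of any two distinct vertices
  -- satisfying P on its left and the other on its right
  Separates : Vertex → (Vertex → Set ℓ₂) → Set ℓ₂
  Separates v P = ∀ {a b} → P a → P b → a ≢ b →
                  (x a < x v × x v < x b) ⊎ (x b < x v × x v < x a)

------------------------------------------------------------------------
-- Mixed cobinary trees

-- Indices are 0-based: t i is the internal node with x-coordinate 1 + toℕ i.
record MCT {c ℓ₁ ℓ₂} (F : OrderedField c ℓ₁ ℓ₂) (n : ℕ) : Set (lsuc 0ℓ ⊔ c ⊔ ℓ₁ ⊔ ℓ₂) where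
  open OrderedField F

  field
    planeTree : PlaneTree F
  open PlaneTree planeTree public

  field
    no-horizontal : ∀ {u v} → Adj u v → ¬ (y u ≈ y v)
    t             : Fin n → Vertex
    t-internal    : ∀ i → Internal (t i)
    t-onto        : ∀ {v} → Internal v → ∃ λ i → t i ≡ v
    t-x           : ∀ i → x (t i) ≈ fromNat (ℕ.suc (toℕ i))
    node-type     : ∀ i → Λ-node (t i) ⊎ V-node (t i)
    Λ-wall        : ∀ i → Λ-node (t i) →
                    (∀ z → z < y (t i) → ¬ OnTree (x (t i)) z) ×
                    Separates (t i) (Child (t i))
    V-wall        : ∀ i → V-node (t i) →
                    (∀ z → y (t i) < z → ¬ OnTree (x (t i)) z) ×
                    Separates (t i) (Parent (t i))

  signVector : Vec Sign n
  signVector = Vec.tabulate λ i → [ const Sign.+ , const Sign.- ]′ (node-type i)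

------------------------------------------------------------------------
-- Integer matrices

Matrix : ℕ → ℕ → Set
Matrix r c = Vector (Vector ℤ c) r

_ᵗ : ∀ {r c} → Matrix r c → Matrix c r
(A ᵗ) i j = A j i

infixl 7 _⊠_
_⊠_ : ∀ {r s c} → Matrix r s → Matrix s c → Matrix r c
(A ⊠ B) i j = Sumℤ.sum λ l → A i l ℤ.* B l j

SameSign : ℤ → ℤ → Set
SameSign a b = (0ℤ ℤ.< a × 0ℤ ℤ.< b) ⊎ (a ℤ.< 0ℤ × b ℤ.< 0ℤ)

sameSign? : ∀ a b → Dec (SameSign a b)
sameSign? a b = (0ℤ ℤ.<? a ×-dec 0ℤ ℤ.<? b) ⊎-dec (a ℤ.<? 0ℤ ×-dec b ℤ.<? 0ℤ)

-- Column k of the upper square block corresponds to row k ↑ˡ m.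
mutate : ∀ {m} → Fin m → Matrix (m ℕ.+ m) m → Matrix (m ℕ.+ m) m
mutate {m} k B i j =
  if does ((i Fin.≟ k ↑ˡ m) ⊎-dec (j Fin.≟ k)) then ℤ.- B i j
  else if does (sameSign? (B i k) (B (k ↑ˡ m) j)) then B i j ℤ.+ B i k ℤ.* ℤ.+ ∣ B (k ↑ˡ m) j ∣
  else B i j

------------------------------------------------------------------------
-- The quiver of a sign vector

-- Vertices are 0-based, so the arrow between consecutive vertices a and b
-- is oriented by the entry of ε whose 0-based position is the larger of the two.
Arrow : ∀ {n} → Vec Sign n → Fin (pred n) → Fin (pred n) → Set
Arrow {n} ε a b =
    (toℕ a ≡ ℕ.suc (toℕ b) × Vec.lookup ε (inject≤ a ℕ.pred[n]≤n) ≡ Sign.+)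
  ⊎ (toℕ b ≡ ℕ.suc (toℕ a) × Vec.lookup ε (inject≤ b ℕ.pred[n]≤n) ≡ Sign.-)

arrow? : ∀ {n} (ε : Vec Sign n) a b → Dec (Arrow ε a b)
arrow? ε a b = (_ ℕ.≟ _ ×-dec _ Sign.≟ _) ⊎-dec (_ ℕ.≟ _ ×-dec _ Sign.≟ _)

Euler : ∀ {n} → Vec Sign n → Matrix (pred n) (pred n)
Euler ε i j = if does (i Fin.≟ j) then 1ℤ else if does (arrow? ε i j) then -1ℤ else 0ℤ

X : ∀ {n} → Vec Sign n → Matrix (pred n) (pred n)
X ε i j = Euler ε i j ℤ.- (Euler ε ᵗ) i j

------------------------------------------------------------------------
-- Internal edges, regions and c-vectors

record EdgeNumbering {c ℓ₁ ℓ₂} {F : OrderedField c ℓ₁ ℓ₂} {n} (T : MCT F n) : Set where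
  open MCT T
  field
    p q       : Fin (pred n) → Fin n
    p<q       : ∀ i → p i Fin.< q i
    edge      : ∀ i → Adj (t (p i)) (t (q i))
    injective : ∀ {i j} → p i ≡ p j → q i ≡ q j → i ≡ j
    onto      : ∀ {a b} → a Fin.< b → Adj (t a) (t b) → ∃ λ i → p i ≡ a × q i ≡ b

module _ {c ℓ₁ ℓ₂} {F : OrderedField c ℓ₁ ℓ₂} {n} {T : MCT F n} (ℓ : EdgeNumbering T) where
  open OrderedField F
  open MCT T
  open EdgeNumbering ℓ

  -- Since x (t (p i)) < x (t (q i)) and no edge is horizontal, the slope
  -- has the sign of y (t (q i)) - y (t (p i)).
  sgn : Fin (pred n) → Sign
  sgn i = if does (y (t (p i)) <? y (t (q i))) then Sign.+ else Sign.-

  Region : Vector Carrier n → Set ℓ₂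
  Region v = ∀ i → 0# < sgn i · (v (q i) - v (p i))

  C : Matrix (pred n) (pred n)
  C r i = sgn i ◃ (if does ((toℕ (p i) ℕ.≤? toℕ r) ×-dec (toℕ r ℕ.<? toℕ (q i))) then 1 else 0)

  exchangeMatrix : Matrix (pred n ℕ.+ pred n) (pred n)
  exchangeMatrix = (C ᵗ ⊠ X signVector ⊠ C) ++ C

module _ {c ℓ₁ ℓ₂} (F : OrderedField c ℓ₁ ℓ₂) where
  open OrderedField F

  -- closure for the topology on Fⁿ given by the open cubes
  Closure : ∀ {n p} → (Vector Carrier n → Set p) → Vector Carrier n → Set (c ⊔ ℓ₂ ⊔ p)
  Closure R v = ∀ δ → 0# < δ →
                ∃ λ w → R w × (∀ i → v i - δ < w i × w i < v i + δ)

------------------------------------------------------------------------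
-- Mutation of trees

record IsMutation {c ℓ₁ ℓ₂} {F : OrderedField c ℓ₁ ℓ₂} {n}
                  (k : Fin (pred n))
                  {T : MCT F n} (ℓ : EdgeNumbering T)
                  {T* : MCT F n} (ℓ* : EdgeNumbering T*) : Set (c ⊔ ℓ₁ ⊔ ℓ₂) where
  open OrderedField F using (Carrier; _≈_)
  open EdgeNumbering ℓ using (p; q)
  field
    sameSigns : MCT.signVector T* ≡ MCT.signVector T
    crossing  : ∀ (v : Vector Carrier n) →
                (Closure F (Region ℓ) v × Closure F (Region ℓ*) v) ⇔
                (Closure F (Region ℓ) v × v (p k) ≈ v (q k))
    c-k       : ∀ r → C ℓ* r k ≡ ℤ.- C ℓ r k
    c-other   : ∀ j → j ≢ k →
                (∀ r → C ℓ* r j ≡ C ℓ r j) ⊎ (∀ r → C ℓ* r j ≡ C ℓ r j ℤ.+ C ℓ r k)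

{-# OPTIONS --safe #-}

-- Orient every internal edge from its lower to its higher end.  The c-vector of
-- u → v then pairs with first differences to give the telescoping functional
-- G ↦ G u - G v, and X is the mixed second difference of
-- Ω x y = sgn (y - x) · ε (max x y).  Hence the entries of CᵗXC are the values
-- of the bilinear extension ω of Ω on the oriented edges, and if c_j changes
-- to c_j + c_k then the edges k and j are consecutive.  In general,
--   * disjoint edges have ω = 0, because the sign of a node tells whether an
--     edge passes above or below it and edges do not cross;
--   * edges meeting at w with other ends a, b have ω = ± ε (median of w, a, b).
-- Comparing T with T*, in which the edge k is reversed, determines the sign of
-- the median: if c_j moves then b_kj = sgn k, and if it stays then
-- sgn k · b_kj ≤ 0.  This is exactly the Fomin–Zelevinsky rule.
module Submission where

open import Defs
import Algebra.Solver.Ring.NaturalCoefficients.Default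
import Algebra.Properties.Semiring.Sum
open import Data.Bool.Base using (true; false; if_then_else_)
open import Data.Empty using (⊥)
open import Data.Fin.Base as Fin using (Fin; zero; suc; toℕ; inject₁; inject≤; _↑ˡ_; _↑ʳ_)
import Data.Fin.Properties as Fin
open import Data.Integer.Base as ℤ using (ℤ; 0ℤ; 1ℤ; -1ℤ; _◃_; ∣_∣)
import Data.Integer.Properties as ℤ
open import Data.Integer.Tactic.RingSolver using (solve-∀)
open import Data.Nat.Base as ℕ using (ℕ; pred)
import Data.Nat.Properties as ℕ
open import Data.Product.Base using (∃; _×_; _,_; proj₁; proj₂)
open import Data.Sign.Base as Sign using (Sign; opposite)
open import Data.Sum.Base as Sum using (_⊎_; inj₁; inj₂; [_,_])
open import Data.Vec.Base as Vec using (Vec)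
open import Data.Vec.Functional.Properties using (lookup-++ˡ; lookup-++ʳ)
import Data.Vec.Properties as Vec
open import Function.Base using (_∘_)
open import Function.Bundles using (mk⇔)
open import Level using (_⊔_)
open import Relation.Binary.Definitions using (tri<; tri≈; tri>)
import Relation.Binary.PropositionalEquality.Core as ≡
open import Relation.Binary.PropositionalEquality.Properties using (module ≡-Reasoning)
import Relation.Binary.Reasoning.Setoid
open import Relation.Binary.Structures using (IsStrictTotalOrder)
open import Relation.Nullary using (¬_; Dec; yes; no; does; contradiction)
open import Relation.Nullary.Decidable using (_×-dec_; does-⇔; dec-true; dec-false)
open ≡ using (_≡_; _≢_)

-- Geometry of mixed cobinary trees

Between : ∀ {n} → Fin n → Fin n → Fin n → Set
Between m a b = (a Fin.< m × m Fin.< b) ⊎ (b Fin.< m × m Fin.< a)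

-- Affine interpolation over an ordered field.

module OrderedFieldProperties {c ℓ₁ ℓ₂} (F : OrderedField c ℓ₁ ℓ₂) where
  open OrderedField F
  open IsStrictTotalOrder isStrictTotalOrder public
    using (<-respˡ-≈; <-respʳ-≈) renaming (irrefl to <-irrefl; trans to <-trans; asym to <-asym)
  open import Relation.Binary.Reasoning.Setoid setoid
  open Algebra.Solver.Ring.NaturalCoefficients.Default commutativeSemiring

  +-monoʳ-< : ∀ z {x y} → x < y → z + x < z + y
  +-monoʳ-< z x<y = <-respˡ-≈ (+-comm _ z) (<-respʳ-≈ (+-comm _ z) (+-monoˡ-< z x<y))

  <-+-pos : ∀ x {d} → 0# < d → x < x + d
  <-+-pos x 0<d = <-respˡ-≈ (+-identityʳ x) (+-monoʳ-< x 0<d)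

  +-pos : ∀ {a b} → 0# < a → 0# < b → 0# < a + b
  +-pos 0<a 0<b = <-trans 0<a (<-+-pos _ 0<b)

  <⇒∃ : ∀ {x y} → x < y → ∃ λ d → 0# < d × y ≈ x + d
  <⇒∃ {x} {y} x<y = y - x , <-respˡ-≈ (-‿inverseʳ x) (+-monoˡ-< (- x) x<y) , (begin
    y              ≈⟨ +-identityʳ y ⟨
    y + 0#         ≈⟨ +-congˡ (-‿inverseˡ x) ⟨
    y + (- x + x)  ≈⟨ +-assoc y (- x) x ⟨
    (y - x) + x    ≈⟨ +-comm (y - x) x ⟩
    x + (y - x)    ∎)

  -- A negative inverse `i` would give `0 = i + d` with `d` positive, hence
  -- `1 < 1 + a d = a (i + d) = 0`.
  inverse-pos : ∀ {a} → 0# < a → ∃ λ i → 0# < i × a * i ≈ 1#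
  inverse-pos {a} 0<a with inverse a (λ a≈0 → <-irrefl (sym a≈0) 0<a)
  ... | i , ai≈1 with compare 0# i
  ...   | tri< 0<i _ _ = i , 0<i , ai≈1
  ...   | tri≈ _ 0≈i _ = contradiction 0<1 (<-irrefl (trans (sym (zeroʳ a)) (trans (*-congˡ 0≈i) ai≈1)))
  ...   | tri> _ _ i<0 with <⇒∃ i<0
  ...     | d , 0<d , 0≈i+d = contradiction 0<1 (<-asym (<-respʳ-≈ 1+ad≈0 (<-+-pos 1# (*-pos 0<a 0<d))))
    where
    1+ad≈0 : 1# + a * d ≈ 0#
    1+ad≈0 = begin
      1# + a * d     ≈⟨ +-congʳ ai≈1 ⟨
      a * i + a * d  ≈⟨ distribˡ a i d ⟨
      a * (i + d)    ≈⟨ *-congˡ 0≈i+d ⟨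
      a * 0#         ≈⟨ zeroʳ a ⟩
      0#             ∎

  0≤-+ : ∀ {a b} → 0# ≤ a → 0# ≤ b → 0# ≤ a + b
  0≤-+ (inj₁ 0<a) (inj₁ 0<b) = inj₁ (+-pos 0<a 0<b)
  0≤-+ (inj₁ 0<a) (inj₂ 0≈b) = inj₁ (<-respʳ-≈ (trans (sym (+-identityʳ _)) (+-congˡ 0≈b)) 0<a)
  0≤-+ (inj₂ 0≈a) (inj₁ 0<b) = inj₁ (<-respʳ-≈ (trans (sym (+-identityˡ _)) (+-congʳ 0≈a)) 0<b)
  0≤-+ (inj₂ 0≈a) (inj₂ 0≈b) = inj₂ (trans (sym (+-identityˡ 0#)) (+-cong 0≈a 0≈b))

  0≤-* : ∀ {a b} → 0# ≤ a → 0# ≤ b → 0# ≤ a * b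
  0≤-* (inj₁ 0<a) (inj₁ 0<b) = inj₁ (*-pos 0<a 0<b)
  0≤-* (inj₁ 0<a) (inj₂ 0≈b) = inj₂ (trans (sym (zeroʳ _)) (*-congˡ 0≈b))
  0≤-* (inj₂ 0≈a) _          = inj₂ (trans (sym (zeroˡ _)) (*-congʳ 0≈a))

  -- Points of a segment are written t u + s v with t + s = 1 instead of
  -- (1 - s) u + s v, so that all identities below are semiring identities.
  record Weights : Set (c ⊔ ℓ₁ ⊔ ℓ₂) where
    constructor weights
    field
      {t s} : Carrier
      0≤t   : 0# ≤ t
      0≤s   : 0# ≤ s
      t+s≈1 : t + s ≈ 1#

    mean : Carrier → Carrier → Carrier
    mean a b = t * a + s * b

    mean-const : ∀ a → mean a a ≈ a
    mean-const a = trans (sym (distribʳ a t s)) (trans (*-congʳ t+s≈1) (*-identityˡ a))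

  open Weights public using (mean; mean-const)

  mean-cong : ∀ w {a a′ b b′} → a ≈ a′ → b ≈ b′ → mean w a b ≈ mean w a′ b′
  mean-cong w p q = +-cong (*-congˡ p) (*-congˡ q)

  left right : Weights
  left  = weights (inj₁ 0<1) (inj₂ refl) (+-identityʳ 1#)
  right = weights (inj₂ refl) (inj₁ 0<1) (+-identityˡ 1#)

  mean-left : ∀ a b → mean left a b ≈ a
  mean-left a b = trans (+-cong (*-identityˡ a) (zeroˡ b)) (+-identityʳ a)

  mean-right : ∀ a b → mean right a b ≈ b
  mean-right a b = trans (+-cong (zeroˡ a) (*-identityˡ b)) (+-identityˡ b)

  -- An average of two averages of the same pair is again an average; its weights are a row vector
  -- times a row-stochastic matrix.
  combine : Weights → Weights → Weights → Weights
  combine w@(weights {t} {s} 0≤t 0≤s _) (weights {t₁} {s₁} 0≤t₁ 0≤s₁ e₁) (weights {t₂} {s₂} 0≤t₂ 0≤s₂ e₂) =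
    weights (0≤-+ (0≤-* 0≤t 0≤t₁) (0≤-* 0≤s 0≤t₂)) (0≤-+ (0≤-* 0≤t 0≤s₁) (0≤-* 0≤s 0≤s₂)) (begin
      (t * t₁ + s * t₂) + (t * s₁ + s * s₂)
        ≈⟨ solve 6 (λ t s t₁ s₁ t₂ s₂ →
             (t :* t₁ :+ s :* t₂) :+ (t :* s₁ :+ s :* s₂) := t :* (t₁ :+ s₁) :+ s :* (t₂ :+ s₂))
             refl t s t₁ s₁ t₂ s₂ ⟩
      mean w (t₁ + s₁) (t₂ + s₂)
        ≈⟨ mean-cong w e₁ e₂ ⟩
      mean w 1# 1#
        ≈⟨ mean-const w 1# ⟩
      1# ∎)

  mean-combine : ∀ w w₁ w₂ a b → mean w (mean w₁ a b) (mean w₂ a b) ≈ mean (combine w w₁ w₂) a b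
  mean-combine (weights {t} {s} _ _ _) (weights {t₁} {s₁} _ _ _) (weights {t₂} {s₂} _ _ _) a b =
    solve 8 (λ t s t₁ s₁ t₂ s₂ a b →
      t :* (t₁ :* a :+ s₁ :* b) :+ s :* (t₂ :* a :+ s₂ :* b) :=
      (t :* t₁ :+ s :* t₂) :* a :+ (t :* s₁ :+ s :* s₂) :* b)
      refl t s t₁ s₁ t₂ s₂ a b

  Inner : Weights → Set ℓ₂
  Inner w = 0# < Weights.t w × 0# < Weights.s w

  mean-< : ∀ w → Inner w → ∀ {a b z} → a < z → b < z → mean w a b < z
  mean-< w@(weights {t} {s} _ _ _) (0<t , 0<s) {a} {b} {z} a<z b<z
    with <⇒∃ a<z | <⇒∃ b<z
  ... | d , 0<d , z≈a+d | e , 0<e , z≈b+e =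
    <-respʳ-≈ (begin
      (t * a + s * b) + (t * d + s * e)
        ≈⟨ solve 6 (λ t s a b d e →
             (t :* a :+ s :* b) :+ (t :* d :+ s :* e) := t :* (a :+ d) :+ s :* (b :+ e))
             refl t s a b d e ⟩
      mean w (a + d) (b + e)
        ≈⟨ mean-cong w z≈a+d z≈b+e ⟨
      mean w z z
        ≈⟨ mean-const w z ⟩
      z ∎)
      (<-+-pos (mean w a b) (+-pos (*-pos 0<t 0<d) (*-pos 0<s 0<e)))

  mean-> : ∀ w → Inner w → ∀ {a b z} → z < a → z < b → z < mean w a b
  mean-> w@(weights {t} {s} _ _ _) (0<t , 0<s) {a} {b} {z} z<a z<b
    with <⇒∃ z<a | <⇒∃ z<b
  ... | d , 0<d , a≈z+d | e , 0<e , b≈z+e =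
    <-respˡ-≈ (mean-const w z) (<-respʳ-≈ (begin
      (t * z + s * z) + (t * d + s * e)
        ≈⟨ solve 5 (λ t s z d e →
             (t :* z :+ s :* z) :+ (t :* d :+ s :* e) := t :* (z :+ d) :+ s :* (z :+ e))
             refl t s z d e ⟩
      mean w (z + d) (z + e)
        ≈⟨ mean-cong w a≈z+d b≈z+e ⟨
      mean w a b ∎)
      (<-+-pos (mean w z z) (+-pos (*-pos 0<t 0<d) (*-pos 0<s 0<e))))

  abstract
    -- Intermediate values for affine functions: if their difference is `d` at one end and `- e` at
    -- the other, they agree at the point with weights `e / (e + d)` and `d / (e + d)`.
    intermediate : ∀ {a₁ a₂ b₁ b₂} → a₁ < b₁ → b₂ < a₂ →
                   ∃ λ w → Inner w × mean w a₁ a₂ ≈ mean w b₁ b₂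
    intermediate {a₁} {a₂} {b₁} {b₂} a₁<b₁ b₂<a₂ with <⇒∃ a₁<b₁ | <⇒∃ b₂<a₂
    ... | d , 0<d , b₁≈ | e , 0<e , a₂≈ with inverse-pos (+-pos 0<e 0<d)
    ...   | i , 0<i , inv =
      weights (inj₁ 0<ei) (inj₁ 0<di) (trans (sym (distribʳ i e d)) inv) , (0<ei , 0<di) , (begin
        e * i * a₁ + d * i * a₂
          ≈⟨ +-congˡ (*-congˡ a₂≈) ⟩
        e * i * a₁ + d * i * (b₂ + e)
          ≈⟨ solve 5 (λ e d i a b →
               e :* i :* a :+ d :* i :* (b :+ e) := e :* i :* (a :+ d) :+ d :* i :* b)
               refl e d i a₁ b₂ ⟩
        e * i * (a₁ + d) + d * i * b₂
          ≈⟨ +-congʳ (*-congˡ b₁≈) ⟨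
        e * i * b₁ + d * i * b₂ ∎)
      where
      0<ei : 0# < e * i
      0<ei = *-pos 0<e 0<i
      0<di : 0# < d * i
      0<di = *-pos 0<d 0<i

  fromNat-pos : ∀ n → 0# < fromNat (ℕ.suc n)
  fromNat-pos ℕ.zero    = <-respʳ-≈ (sym (+-identityʳ 1#)) 0<1
  fromNat-pos (ℕ.suc n) = +-pos 0<1 (fromNat-pos n)

  fromNat-mono-< : ∀ {m n} → m ℕ.< n → fromNat m < fromNat n
  fromNat-mono-< {ℕ.zero}  {ℕ.suc n} _   = fromNat-pos n
  fromNat-mono-< {ℕ.suc m} {ℕ.suc n} m<n = +-monoʳ-< 1# (fromNat-mono-< (ℕ.s≤s⁻¹ m<n))

-- Walls, signs of nodes and non-crossing edges.

module Geometry {c ℓ₁ ℓ₂} {F : OrderedField c ℓ₁ ℓ₂} {n} (T : MCT F n) where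
  open OrderedField F hiding (_-_)
  open OrderedFieldProperties F
  open MCT T

  ε : Fin n → Sign
  ε = Vec.lookup signVector

  xₜ yₜ : Fin n → Carrier
  xₜ i = x (t i)
  yₜ i = y (t i)

  xₜ-mono : ∀ {i j} → i Fin.< j → xₜ i < xₜ j
  xₜ-mono {i} {j} i<j = <-respˡ-≈ (sym (t-x i)) (<-respʳ-≈ (sym (t-x j)) (fromNat-mono-< (ℕ.s≤s i<j)))

  t-injective : ∀ {i j} → t i ≡ t j → i ≡ j
  t-injective {i} {j} eq with Fin.<-cmp i j
  ... | tri< i<j _ _ = contradiction (xₜ-mono i<j) (<-irrefl (reflexive (≡.cong x eq)))
  ... | tri≈ _ i≡j _ = i≡j
  ... | tri> _ _ j<i = contradiction (xₜ-mono j<i) (<-irrefl (reflexive (≡.cong x (≡.sym eq))))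

  node : ∀ i → (ε i ≡ Sign.+ × Λ-node (t i)) ⊎ (ε i ≡ Sign.- × V-node (t i))
  node i with node-type i in eq
  ... | inj₁ Λ = inj₁ (≡.trans (Vec.lookup∘tabulate _ i) (≡.cong [ (λ _ → Sign.+) , (λ _ → Sign.-) ] eq) , Λ)
  ... | inj₂ V = inj₂ (≡.trans (Vec.lookup∘tabulate _ i) (≡.cong [ (λ _ → Sign.+) , (λ _ → Sign.-) ] eq) , V)

  weights⇒OnEdge : ∀ {u v a b} w → a ≈ mean w (x u) (x v) → b ≈ mean w (y u) (y v) → OnEdge u v a b
  weights⇒OnEdge {u} {v} (weights {t} {s} 0≤t 0≤s t+s≈1) a≈ b≈ =
    s , 0≤s , s≤1 0≤t ,
    trans a≈ (+-congʳ (*-congʳ t≈1-s)) , trans b≈ (+-congʳ (*-congʳ t≈1-s))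
    where
    open OrderedField F using (_-_)
    open Relation.Binary.Reasoning.Setoid setoid
    t≈1-s : t ≈ 1# - s
    t≈1-s = begin
      t              ≈⟨ +-identityʳ t ⟨
      t + 0#         ≈⟨ +-congˡ (-‿inverseʳ s) ⟨
      t + (s - s)    ≈⟨ +-assoc t s (- s) ⟨
      (t + s) - s    ≈⟨ +-congʳ t+s≈1 ⟩
      1# - s         ∎
    s≤1 : 0# ≤ t → s ≤ 1#
    s≤1 (inj₁ 0<t) = inj₁ (<-respʳ-≈ (trans (+-comm s t) t+s≈1) (<-+-pos s 0<t))
    s≤1 (inj₂ 0≈t) = inj₂ (trans (sym (+-identityˡ s)) (trans (+-congʳ 0≈t) t+s≈1))

  Edge : Fin n → Fin n → Set
  Edge a b = Adj (t a) (t b)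

  On : Fin n → Fin n → Carrier → Carrier → Set _
  On a b ξ η = ∃ λ w → ξ ≈ mean w (xₜ a) (xₜ b) × η ≈ mean w (yₜ a) (yₜ b)

  on-left : ∀ a b → On a b (xₜ a) (yₜ a)
  on-left a b = left , sym (mean-left _ _) , sym (mean-left _ _)

  on-right : ∀ a b → On a b (xₜ b) (yₜ b)
  on-right a b = right , sym (mean-right _ _) , sym (mean-right _ _)

  on-mean : ∀ {a b ξ₁ η₁ ξ₂ η₂} w → On a b ξ₁ η₁ → On a b ξ₂ η₂ →
            On a b (mean w ξ₁ ξ₂) (mean w η₁ η₂)
  on-mean w (w₁ , p₁ , q₁) (w₂ , p₂ , q₂) =
    combine w w₁ w₂ , trans (mean-cong w p₁ p₂) (mean-combine w w₁ w₂ _ _) ,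
                      trans (mean-cong w q₁ q₂) (mean-combine w w₁ w₂ _ _)

  abstract
    -- Comparing the x-coordinate along the segment with the constant `xₜ m`, `intermediate` finds
    -- the point on the vertical line through `m`.
    over : ∀ {a b m} → a Fin.< m → m Fin.< b →
           ∃ λ w → Inner w × xₜ m ≈ mean w (xₜ a) (xₜ b)
    over {m = m} a<m m<b with intermediate (xₜ-mono a<m) (xₜ-mono m<b)
    ... | w , inner , eq = w , inner , trans (sym (mean-const w (xₜ m))) (sym eq)

  -- The wall above a V-node misses the tree, so an edge passing above `m` leaves only the positive
  -- type.
  above⇒Λ : ∀ {a b m z} → Edge a b → On a b (xₜ m) z → yₜ m < z → ε m ≡ Sign.+
  above⇒Λ {a} {b} {m} {z} ab (w , ξ≈ , η≈) ym<z with node m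
  ... | inj₁ (ε≡ , _) = ε≡
  ... | inj₂ (_ , V)  = contradiction (t a , t b , ab , weights⇒OnEdge w ξ≈ η≈) (proj₁ (V-wall m V) z ym<z)

  below⇒V : ∀ {a b m z} → Edge a b → On a b (xₜ m) z → z < yₜ m → ε m ≡ Sign.-
  below⇒V {a} {b} {m} {z} ab (w , ξ≈ , η≈) z<ym with node m
  ... | inj₁ (_ , Λ)  = contradiction (t a , t b , ab , weights⇒OnEdge w ξ≈ η≈) (proj₁ (Λ-wall m Λ) z z<ym)
  ... | inj₂ (ε≡ , _) = ε≡

  -- By convexity the point of the edge on the line through `m` is lower than `m`, as both ends are.
  peak : ∀ {a b m} → Edge a b → Between m a b → yₜ a < yₜ m → yₜ b < yₜ m → ε m ≡ Sign.-
  peak ab (inj₁ (a<m , m<b)) ya<ym yb<ym with over a<m m<b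
  ... | w , inner , eq = below⇒V ab (w , eq , refl) (mean-< w inner ya<ym yb<ym)
  peak ab (inj₂ m∈ba) ya<ym yb<ym = peak (adj-sym ab) (inj₁ m∈ba) yb<ym ya<ym

  valley : ∀ {a b m} → Edge a b → Between m a b → yₜ m < yₜ a → yₜ m < yₜ b → ε m ≡ Sign.+
  valley ab (inj₁ (a<m , m<b)) ym<ya ym<yb with over a<m m<b
  ... | w , inner , eq = above⇒Λ ab (w , eq , refl) (mean-> w inner ym<ya ym<yb)
  valley ab (inj₂ m∈ba) ym<ya ym<yb = valley (adj-sym ab) (inj₁ m∈ba) ym<yb ym<ya

  t-between : ∀ {a b m} → (x (t a) < xₜ m × xₜ m < x (t b)) ⊎ (x (t b) < xₜ m × xₜ m < x (t a)) →
              Between m a b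
  t-between = Sum.map (λ (p , q) → reflect p , reflect q) (λ (p , q) → reflect p , reflect q)
    where
    reflect : ∀ {i j} → xₜ i < xₜ j → i Fin.< j
    reflect {i} {j} p with Fin.<-cmp i j
    ... | tri< i<j _ _ = i<j
    ... | tri≈ _ ≡.refl _ = contradiction p (<-irrefl refl)
    ... | tri> _ _ j<i = contradiction p (<-asym (xₜ-mono j<i))

  -- A Λ-node has a single parent, so `m` is a V-node and its upper wall separates `a` from `b`.
  two-parents : ∀ {m a b} → Edge m a → Edge m b → yₜ m < yₜ a → yₜ m < yₜ b → a ≢ b →
                ε m ≡ Sign.- × Between m a b
  two-parents {m} ma mb m<a m<b a≢b with node m
  ... | inj₁ (_ , _ , _ , _ , unique) =
    contradiction (t-injective (≡.trans (≡.sym (unique (ma , m<a))) (unique (mb , m<b)))) a≢b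
  ... | inj₂ (ε≡ , V) = ε≡ , t-between (proj₂ (V-wall m V) (ma , m<a) (mb , m<b) (a≢b ∘ t-injective))

  two-children : ∀ {m a b} → Edge m a → Edge m b → yₜ a < yₜ m → yₜ b < yₜ m → a ≢ b →
                 ε m ≡ Sign.+ × Between m a b
  two-children {m} ma mb a<m b<m a≢b with node m
  ... | inj₁ (ε≡ , Λ) = ε≡ , t-between (proj₂ (Λ-wall m Λ) (ma , a<m) (mb , b<m) (a≢b ∘ t-injective))
  ... | inj₂ (_ , (_ , _ , unique) , _) =
    contradiction (t-injective (≡.trans (≡.sym (unique (ma , a<m))) (unique (mb , b<m)))) a≢b

  module Disjoint {a b c d} (ab : Edge a b) (cd : Edge c d)
                  (a≢c : a ≢ c) (a≢d : a ≢ d) (b≢c : b ≢ c) (b≢d : b ≢ d) where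

    disjoint : ∀ {ξ η} → On a b ξ η → On c d ξ η → ⊥
    disjoint (w₁ , p₁ , q₁) (w₂ , p₂ , q₂)
      with edges-meet ab cd (λ (eq , _) → a≢c (t-injective eq)) (λ (eq , _) → a≢d (t-injective eq))
                      (weights⇒OnEdge w₁ p₁ q₁) (weights⇒OnEdge w₂ p₂ q₂)
    ... | _ , inj₁ u , inj₁ v , _ = a≢c (t-injective (≡.trans (≡.sym u) v))
    ... | _ , inj₁ u , inj₂ v , _ = a≢d (t-injective (≡.trans (≡.sym u) v))
    ... | _ , inj₂ u , inj₁ v , _ = b≢c (t-injective (≡.trans (≡.sym u) v))
    ... | _ , inj₂ u , inj₂ v , _ = b≢d (t-injective (≡.trans (≡.sym u) v))

    never-equal : ∀ {ξ η ζ} → On a b ξ η → On c d ξ ζ → ¬ η ≈ ζ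
    never-equal e (w , p , q) η≈ζ = disjoint e (w , p , trans η≈ζ q)

    -- The difference of heights is affine between the two abscissae; a change of sign would produce
    -- a common point.
    no-crossing : ∀ {ξ₁ ξ₂ η₁ η₂ ζ₁ ζ₂} → On a b ξ₁ η₁ → On a b ξ₂ η₂ →
                  On c d ξ₁ ζ₁ → On c d ξ₂ ζ₂ →
                  η₁ < ζ₁ → ζ₂ < η₂ → ⊥
    no-crossing e₁ e₂ f₁ f₂ η₁<ζ₁ ζ₂<η₂ with intermediate η₁<ζ₁ ζ₂<η₂
    ... | w , _ , eq = never-equal (on-mean w e₁ e₂) (on-mean w f₁ f₂) eq

    stays-below : ∀ {ξ₁ ξ₂ η₁ η₂ ζ₁ ζ₂} → On a b ξ₁ η₁ → On a b ξ₂ η₂ →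
                  On c d ξ₁ ζ₁ → On c d ξ₂ ζ₂ →
                  η₁ < ζ₁ → η₂ < ζ₂
    stays-below {η₂ = η₂} {ζ₂ = ζ₂} e₁ e₂ f₁ f₂ η₁<ζ₁ with compare η₂ ζ₂
    ... | tri< η₂<ζ₂ _ _ = η₂<ζ₂
    ... | tri≈ _ η₂≈ζ₂ _ = contradiction η₂≈ζ₂ (never-equal e₂ f₂)
    ... | tri> _ _ ζ₂<η₂ = contradiction ζ₂<η₂ (no-crossing e₁ e₂ f₁ f₂ η₁<ζ₁)

    stays-above : ∀ {ξ₁ ξ₂ η₁ η₂ ζ₁ ζ₂} → On a b ξ₁ η₁ → On a b ξ₂ η₂ →
                  On c d ξ₁ ζ₁ → On c d ξ₂ ζ₂ →
                  ζ₁ < η₁ → ζ₂ < η₂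
    stays-above {η₂ = η₂} {ζ₂ = ζ₂} e₁ e₂ f₁ f₂ ζ₁<η₁ with compare η₂ ζ₂
    ... | tri< η₂<ζ₂ _ _ = contradiction ζ₁<η₁ (no-crossing e₂ e₁ f₂ f₁ η₂<ζ₂)
    ... | tri≈ _ η₂≈ζ₂ _ = contradiction η₂≈ζ₂ (never-equal e₂ f₂)
    ... | tri> _ _ ζ₂<η₂ = ζ₂<η₂

    -- The edge that is lower at `c` is still lower at `b`. Thus `c` sees `ab` on one side and `b`
    -- sees `cd` on the other, and the walls give opposite signs.
    overlapping : a Fin.< c → c Fin.< b → b Fin.< d → ε b ≡ opposite (ε c)
    overlapping a<c c<b b<d with over a<c c<b | over c<b b<d
    ... | w₁ , _ , p | w₂ , _ , q with compare (mean w₁ (yₜ a) (yₜ b)) (yₜ c)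
    ...   | tri< η<yc _ _ =
      ≡.trans (above⇒Λ cd (w₂ , q , refl)
                (stays-below (w₁ , p , refl) (on-right a b) (on-left c d) (w₂ , q , refl) η<yc))
              (≡.cong opposite (≡.sym (below⇒V ab (w₁ , p , refl) η<yc)))
    ...   | tri≈ _ η≈yc _ = contradiction η≈yc (never-equal (w₁ , p , refl) (on-left c d))
    ...   | tri> _ _ yc<η =
      ≡.trans (below⇒V cd (w₂ , q , refl)
                (stays-above (w₁ , p , refl) (on-right a b) (on-left c d) (w₂ , q , refl) yc<η))
              (≡.cong opposite (≡.sym (above⇒Λ ab (w₁ , p , refl) yc<η)))

    -- Both `c` and `d` see the longer edge `ab` on the same side.
    nested : a Fin.< c → c Fin.< d → d Fin.< b → ε d ≡ ε c
    nested a<c c<d d<b with over a<c (ℕ.<-trans c<d d<b) | over (ℕ.<-trans a<c c<d) d<b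
    ... | w₁ , _ , p | w₂ , _ , q with compare (mean w₁ (yₜ a) (yₜ b)) (yₜ c)
    ...   | tri< η<yc _ _ =
      ≡.trans (below⇒V ab (w₂ , q , refl)
                (stays-below (w₁ , p , refl) (w₂ , q , refl) (on-left c d) (on-right c d) η<yc))
              (≡.sym (below⇒V ab (w₁ , p , refl) η<yc))
    ...   | tri≈ _ η≈yc _ = contradiction η≈yc (never-equal (w₁ , p , refl) (on-left c d))
    ...   | tri> _ _ yc<η =
      ≡.trans (above⇒Λ ab (w₂ , q , refl)
                (stays-above (w₁ , p , refl) (w₂ , q , refl) (on-left c d) (on-right c d) yc<η))
              (≡.sym (above⇒Λ ab (w₁ , p , refl) yc<η))

-- Exchange matrices as values of a bilinear form on oriented edges

open ≡ using (refl; sym; trans; cong; cong₂; subst)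
open import Data.Integer.Base using (_+_; _-_; _*_; -_)
module Sumℤ = Algebra.Properties.Semiring.Sum ℤ.+-*-semiring
open Sumℤ using (sum)

Arc : ℕ → Set
Arc n = Fin n × Fin n

-- Tail minus head: for arcs pointing upwards this is the sign with which a c-vector, paired with
-- `Δ`, gives `∂`.
∂ : ∀ {n} → Arc n → (Fin n → ℤ) → ℤ
∂ (u , v) F = F u - F v

∂-comm : ∀ {n} (e e′ : Arc n) (G : Fin n → Fin n → ℤ) →
         ∂ e (λ x → ∂ e′ λ y → G y x) ≡ ∂ e′ λ y → ∂ e λ x → G y x
∂-comm (a , b) (c , d) G = lemma (G c a) (G d a) (G c b) (G d b)
  where
  lemma : ∀ x y z w → (x - y) - (z - w) ≡ (x - z) - (y - w)
  lemma = solve-∀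

orient : ∀ {n} → Sign → Fin n → Fin n → Arc n
orient Sign.+ a b = a , b
orient Sign.- a b = b , a

∂-orient : ∀ {n} s (a b : Fin n) F → ∂ (orient s a b) F ≡ (s ◃ 1) * (F a - F b)
∂-orient Sign.+ a b F = sym (ℤ.*-identityˡ _)
∂-orient Sign.- a b F = lemma (F a) (F b)
  where
  lemma : ∀ x y → y - x ≡ -1ℤ * (x - y)
  lemma = solve-∀

-- Repeats the condition in `C` literally, so that a column of `C` is by computation a sign applied
-- to an indicator.
indicator : ∀ {m} → Fin (ℕ.suc m) → Fin (ℕ.suc m) → Fin m → ℕ
indicator a b r = if does ((toℕ a ℕ.≤? toℕ r) ×-dec (toℕ r ℕ.<? toℕ b)) then 1 else 0

indicator-suc : ∀ {m} (a b : Fin (ℕ.suc m)) r → indicator (suc a) (suc b) (suc r) ≡ indicator a b r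
indicator-suc a b r = cong (if_then 1 else 0)
  (does-⇔ (mk⇔ (λ (x , y) → ℕ.s≤s⁻¹ x , ℕ.s≤s⁻¹ y) (λ (x , y) → ℕ.s≤s x , ℕ.s≤s y))
    (toℕ (suc a) ℕ.≤? toℕ (suc r) ×-dec toℕ (suc r) ℕ.<? toℕ (suc b))
    (toℕ a ℕ.≤? toℕ r ×-dec toℕ r ℕ.<? toℕ b))

indicator-zero-suc : ∀ {m} (b : Fin (ℕ.suc m)) r → indicator zero (suc b) (suc r) ≡ indicator zero b r
indicator-zero-suc b r = cong (if_then 1 else 0)
  (does-⇔ (mk⇔ (λ (_ , y) → ℕ.z≤n , ℕ.s≤s⁻¹ y) (λ (_ , y) → ℕ.z≤n , ℕ.s≤s y))
    (0 ℕ.≤? toℕ (suc r) ×-dec toℕ (suc r) ℕ.<? toℕ (suc b)) (0 ℕ.≤? toℕ r ×-dec toℕ r ℕ.<? toℕ b))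

Δ : ∀ {m} → (Fin (ℕ.suc m) → ℤ) → Fin m → ℤ
Δ F r = F (inject₁ r) - F (suc r)

telescope : ∀ {m} (a b : Fin (ℕ.suc m)) (F : Fin (ℕ.suc m) → ℤ) → a Fin.≤ b →
            sum (λ r → ℤ.+ indicator a b r * Δ F r) ≡ F a - F b
telescope {m} zero zero F _ = trans (Sumℤ.sum-replicate-zero m) (sym (ℤ.+-inverseʳ (F zero)))
telescope {ℕ.suc m} zero (suc b) F _ = begin
  1ℤ * (F zero - F (suc zero)) + sum (λ r → ℤ.+ indicator zero (suc b) (suc r) * Δ F (suc r))
    ≡⟨ cong (λ z → 1ℤ * (F zero - F (suc zero)) + z)
         (Sumℤ.sum-cong-≗ λ r → cong (λ z → ℤ.+ z * Δ F (suc r)) (indicator-zero-suc b r)) ⟩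
  1ℤ * (F zero - F (suc zero)) + sum (λ r → ℤ.+ indicator zero b r * Δ (F ∘ suc) r)
    ≡⟨ cong (λ z → 1ℤ * (F zero - F (suc zero)) + z) (telescope zero b (F ∘ suc) ℕ.z≤n) ⟩
  1ℤ * (F zero - F (suc zero)) + (F (suc zero) - F (suc b))
    ≡⟨ lemma (F zero) (F (suc zero)) (F (suc b)) ⟩
  F zero - F (suc b) ∎
  where
  open ≡-Reasoning
  lemma : ∀ x y z → 1ℤ * (x - y) + (y - z) ≡ x - z
  lemma = solve-∀
telescope {ℕ.suc m} (suc a) (suc b) F a≤b = begin
  0ℤ * Δ F zero + sum (λ r → ℤ.+ indicator (suc a) (suc b) (suc r) * Δ F (suc r))
    ≡⟨ ℤ.+-identityˡ _ ⟩
  sum (λ r → ℤ.+ indicator (suc a) (suc b) (suc r) * Δ F (suc r))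
    ≡⟨ Sumℤ.sum-cong-≗ (λ r → cong (λ z → ℤ.+ z * Δ F (suc r)) (indicator-suc a b r)) ⟩
  sum (λ r → ℤ.+ indicator a b r * Δ (F ∘ suc) r)
    ≡⟨ telescope a b (F ∘ suc) (ℕ.s≤s⁻¹ a≤b) ⟩
  F (suc a) - F (suc b) ∎
  where open ≡-Reasoning

◃≡ : ∀ s n → s ◃ n ≡ (s ◃ 1) * ℤ.+ n
◃≡ Sign.+ n = trans (ℤ.+◃n≡+n n) (sym (ℤ.*-identityˡ (ℤ.+ n)))
◃≡ Sign.- n = trans (ℤ.-◃n≡-n n) (sym (ℤ.-1*i≡-i (ℤ.+ n)))

signed-telescope : ∀ {m} s (a b : Fin (ℕ.suc m)) (F : Fin (ℕ.suc m) → ℤ) → a Fin.≤ b →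
                   sum (λ r → (s ◃ indicator a b r) * Δ F r) ≡ ∂ (orient s a b) F
signed-telescope s a b F a≤b = begin
  sum (λ r → (s ◃ indicator a b r) * Δ F r)
    ≡⟨ Sumℤ.sum-cong-≗ (λ r → trans (cong (_* Δ F r) (◃≡ s (indicator a b r))) (ℤ.*-assoc (s ◃ 1) _ _)) ⟩
  sum (λ r → (s ◃ 1) * (ℤ.+ indicator a b r * Δ F r))
    ≡⟨ Sumℤ.*-distribˡ-sum (s ◃ 1) (λ r → ℤ.+ indicator a b r * Δ F r) ⟨
  (s ◃ 1) * sum (λ r → ℤ.+ indicator a b r * Δ F r)
    ≡⟨ cong ((s ◃ 1) *_) (telescope a b F a≤b) ⟩
  (s ◃ 1) * (F a - F b)
    ≡⟨ ∂-orient s a b F ⟨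
  ∂ (orient s a b) F ∎
  where open ≡-Reasoning

-- The skew form whose mixed second difference is `X`.

module Pairing {n : ℕ} (ε : Fin n → Sign) where

  ⟦_⟧ : Fin n → ℤ
  ⟦ x ⟧ = ε x ◃ 1

  Ω : Fin n → Fin n → ℤ
  Ω x y with Fin.<-cmp x y
  ... | tri< _ _ _ = ⟦ y ⟧
  ... | tri≈ _ _ _ = 0ℤ
  ... | tri> _ _ _ = - ⟦ x ⟧

  Ω-< : ∀ {x y} → x Fin.< y → Ω x y ≡ ⟦ y ⟧
  Ω-< {x} {y} x<y with Fin.<-cmp x y
  ... | tri< _ _ _ = refl
  ... | tri≈ x≮y _ _ = contradiction x<y x≮y
  ... | tri> x≮y _ _ = contradiction x<y x≮y

  Ω-> : ∀ {x y} → y Fin.< x → Ω x y ≡ - ⟦ x ⟧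
  Ω-> {x} {y} y<x with Fin.<-cmp x y
  ... | tri< _ _ y≮x = contradiction y<x y≮x
  ... | tri≈ _ _ y≮x = contradiction y<x y≮x
  ... | tri> _ _ _ = refl

  Ω-diag : ∀ x → Ω x x ≡ 0ℤ
  Ω-diag x with Fin.<-cmp x x
  ... | tri< _ x≢x _ = contradiction refl x≢x
  ... | tri≈ _ _ _ = refl
  ... | tri> _ x≢x _ = contradiction refl x≢x

  Ω-skew : ∀ x y → Ω x y ≡ - Ω y x
  Ω-skew x y with Fin.<-cmp x y
  ... | tri< x<y _ _ = sym (trans (cong -_ (Ω-> x<y)) (ℤ.neg-involutive ⟦ y ⟧))
  ... | tri≈ _ refl _ = sym (cong -_ (Ω-diag x))
  ... | tri> _ _ y<x = sym (cong -_ (Ω-< y<x))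

  ω : Arc n → Arc n → ℤ
  ω e e′ = ∂ e λ x → ∂ e′ (Ω x)

  ω-skew : ∀ e e′ → ω e e′ ≡ - ω e′ e
  ω-skew (a , b) (c , d)
    rewrite Ω-skew c a | Ω-skew c b | Ω-skew d a | Ω-skew d b = lemma (Ω a c) (Ω a d) (Ω b c) (Ω b d)
    where
    lemma : ∀ x y z w → (x - y) - (z - w) ≡ - ((- x - - z) - (- y - - w))
    lemma = solve-∀

  ω-alternating : ∀ e → ω e e ≡ 0ℤ
  ω-alternating (a , b) rewrite Ω-diag a | Ω-diag b | Ω-skew a b = lemma (Ω b a)
    where
    lemma : ∀ x → (0ℤ - - x) - (x - 0ℤ) ≡ 0ℤ
    lemma = solve-∀

module _ {m : ℕ} (ε : Vec Sign (ℕ.suc m)) where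
  open Pairing (Vec.lookup ε)

  private
    at-inject₁ : ∀ (i : Fin m) → inject≤ i (ℕ.pred[n]≤n {ℕ.suc m}) ≡ inject₁ i
    at-inject₁ i = Fin.toℕ-injective (trans (Fin.toℕ-inject≤ i _) (sym (Fin.toℕ-inject₁ i)))

  X-skew : ∀ i j → X ε i j ≡ - X ε j i
  X-skew i j = lemma (Euler ε i j) (Euler ε j i)
    where
    lemma : ∀ x y → x - y ≡ - (y - x)
    lemma = solve-∀

  Euler-no-arrow : ∀ {i j} → i ≢ j → ¬ Arrow ε i j → Euler ε i j ≡ 0ℤ
  Euler-no-arrow {i} {j} i≢j ¬a
    rewrite dec-false (i Fin.≟ j) i≢j | dec-false (arrow? ε i j) ¬a = refl

  Euler-arrow : ∀ {i j} → i ≢ j → Arrow ε i j → Euler ε i j ≡ -1ℤ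
  Euler-arrow {i} {j} i≢j a
    rewrite dec-false (i Fin.≟ j) i≢j | dec-true (arrow? ε i j) a = refl

  X-far : ∀ {i j} → ℕ.suc (toℕ i) ℕ.< toℕ j → X ε i j ≡ 0ℤ
  X-far {i} {j} far = cong₂ _-_ (Euler-no-arrow i≢j no-arrow) (Euler-no-arrow (i≢j ∘ sym) no-arrow′)
    where
    i<j : i Fin.< j
    i<j = ℕ.<-trans (ℕ.n<1+n _) far
    i≢j : i ≢ j
    i≢j refl = ℕ.<-irrefl refl i<j
    no-arrow : ¬ Arrow ε i j
    no-arrow (inj₁ (eq , _)) = ℕ.<-asym i<j (ℕ.≤-reflexive (sym eq))
    no-arrow (inj₂ (eq , _)) = ℕ.<-irrefl (sym eq) far
    no-arrow′ : ¬ Arrow ε j i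
    no-arrow′ (inj₁ (eq , _)) = ℕ.<-irrefl (sym eq) far
    no-arrow′ (inj₂ (eq , _)) = ℕ.<-asym i<j (ℕ.≤-reflexive (sym eq))

  -- The arrow between the two vertices is oriented by the node that the two gaps share, which is
  -- `inject₁ j` as well as `suc i`. An arrow out of `j` contributes 1, an arrow into `j`
  -- contributes -1.
  X-next : ∀ {i j} → ℕ.suc (toℕ i) ≡ toℕ j → X ε i j ≡ ⟦ inject₁ j ⟧
  X-next {i} {j} eq = by-sign (Vec.lookup ε (inject₁ j)) (cong (Vec.lookup ε) (at-inject₁ j))
    where
    i≢j : i ≢ j
    i≢j refl = ℕ.<-irrefl (sym eq) (ℕ.n<1+n _)
    not-prev : toℕ i ≢ ℕ.suc (toℕ j)
    not-prev eq′ = ℕ.<-asym (ℕ.≤-reflexive eq) (ℕ.≤-reflexive (sym eq′))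
    by-sign : ∀ s → Vec.lookup ε (inject≤ j ℕ.pred[n]≤n) ≡ s → X ε i j ≡ s ◃ 1
    by-sign Sign.+ s≡+ =
      cong₂ _-_ (Euler-no-arrow i≢j no-arrow) (Euler-arrow (i≢j ∘ sym) (inj₁ (sym eq , s≡+)))
      where
      no-arrow : ¬ Arrow ε i j
      no-arrow (inj₁ (eq′ , _)) = not-prev eq′
      no-arrow (inj₂ (_ , s≡-)) with () ← trans (sym s≡+) s≡-
    by-sign Sign.- s≡- =
      cong₂ _-_ (Euler-arrow i≢j (inj₂ (sym eq , s≡-))) (Euler-no-arrow (i≢j ∘ sym) no-arrow)
      where
      no-arrow : ¬ Arrow ε j i
      no-arrow (inj₁ (_ , s≡+)) with () ← trans (sym s≡+) s≡-
      no-arrow (inj₂ (eq′ , _)) = not-prev eq′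

  ΔΔΩ : Fin m → Fin m → ℤ
  ΔΔΩ i j = Δ (λ x → Δ (Ω x) j) i

  ΔΔΩ-skew : ∀ i j → ΔΔΩ i j ≡ - ΔΔΩ j i
  ΔΔΩ-skew i j = ω-skew (inject₁ i , suc i) (inject₁ j , suc j)

  -- Three of the four values are settled by `i < j`. The fourth stays open because `suc i` and
  -- `inject₁ j` may coincide.
  ΔΔΩ-< : ∀ {i j} → i Fin.< j →
          ΔΔΩ i j ≡ ⟦ inject₁ j ⟧ - ⟦ suc j ⟧ - (Ω (suc i) (inject₁ j) - ⟦ suc j ⟧)
  ΔΔΩ-< {i} {j} i<j =
    cong₂ _-_ (cong₂ _-_ (Ω-< i⁻<j⁻) (Ω-< i⁻<j⁺))
      (cong (λ z → Ω (suc i) (inject₁ j) - z) (Ω-< {suc i} {suc j} (ℕ.s≤s i<j)))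
    where
    i⁻<j⁺ : inject₁ i Fin.< suc j
    i⁻<j⁺ = subst (ℕ._< ℕ.suc (toℕ j)) (sym (Fin.toℕ-inject₁ i)) (ℕ.m<n⇒m<1+n i<j)
    i⁻<j⁻ : inject₁ i Fin.< inject₁ j
    i⁻<j⁻ = subst (toℕ (inject₁ i) ℕ.<_) (sym (Fin.toℕ-inject₁ j))
              (subst (ℕ._< toℕ j) (sym (Fin.toℕ-inject₁ i)) i<j)

  -- For distant gaps all four comparisons go the same way and the values cancel. For adjacent gaps
  -- the shared node gives a diagonal value 0, and `⟦ inject₁ j ⟧` survives.
  X≡ΔΔΩ-< : ∀ {i j} → i Fin.< j → X ε i j ≡ ΔΔΩ i j
  X≡ΔΔΩ-< {i} {j} i<j with ℕ.<-cmp (ℕ.suc (toℕ i)) (toℕ j)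
  ... | tri< far _ _ = begin
    X ε i j                                                      ≡⟨ X-far far ⟩
    0ℤ                                                           ≡⟨ ℤ.+-inverseʳ (⟦ inject₁ j ⟧ - ⟦ suc j ⟧) ⟨
    ⟦ inject₁ j ⟧ - ⟦ suc j ⟧ - (⟦ inject₁ j ⟧ - ⟦ suc j ⟧)      ≡⟨ last-step (sym (Ω-< i⁺<j⁻)) ⟩
    ⟦ inject₁ j ⟧ - ⟦ suc j ⟧ - (Ω (suc i) (inject₁ j) - ⟦ suc j ⟧) ≡⟨ ΔΔΩ-< i<j ⟨
    ΔΔΩ i j                                                      ∎
    where
    open ≡-Reasoning
    last-step = cong (λ z → ⟦ inject₁ j ⟧ - ⟦ suc j ⟧ - (z - ⟦ suc j ⟧))
    i⁺<j⁻ : suc i Fin.< inject₁ j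
    i⁺<j⁻ = subst (ℕ.suc (toℕ i) ℕ.<_) (sym (Fin.toℕ-inject₁ j)) far
  ... | tri≈ _ eq _ = begin
    X ε i j                                                      ≡⟨ X-next eq ⟩
    ⟦ inject₁ j ⟧                                                ≡⟨ lemma ⟦ inject₁ j ⟧ ⟦ suc j ⟧ ⟩
    ⟦ inject₁ j ⟧ - ⟦ suc j ⟧ - (0ℤ - ⟦ suc j ⟧)                 ≡⟨ last-step (sym Ω≡0) ⟩
    ⟦ inject₁ j ⟧ - ⟦ suc j ⟧ - (Ω (suc i) (inject₁ j) - ⟦ suc j ⟧) ≡⟨ ΔΔΩ-< i<j ⟨
    ΔΔΩ i j                                                      ∎
    where
    open ≡-Reasoning
    last-step = cong (λ z → ⟦ inject₁ j ⟧ - ⟦ suc j ⟧ - (z - ⟦ suc j ⟧))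
    i⁺≡j⁻ : suc i ≡ inject₁ j
    i⁺≡j⁻ = Fin.toℕ-injective (trans eq (sym (Fin.toℕ-inject₁ j)))
    Ω≡0 : Ω (suc i) (inject₁ j) ≡ 0ℤ
    Ω≡0 = trans (cong (Ω (suc i)) (sym i⁺≡j⁻)) (Ω-diag (suc i))
    lemma : ∀ x y → x ≡ x - y - (0ℤ - y)
    lemma = solve-∀
  ... | tri> _ _ gt = contradiction gt (ℕ.≤⇒≯ i<j)

  X≡ΔΔΩ : ∀ i j → X ε i j ≡ ΔΔΩ i j
  X≡ΔΔΩ i j with ℕ.<-cmp (toℕ i) (toℕ j)
  ... | tri< i<j _ _ = X≡ΔΔΩ-< i<j
  ... | tri≈ _ i≡j _ with refl ← Fin.toℕ-injective i≡j =
    trans (ℤ.+-inverseʳ (Euler ε i i)) (sym (ω-alternating (inject₁ i , suc i)))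
  ... | tri> _ _ i>j = trans (X-skew i j) (trans (cong -_ (X≡ΔΔΩ-< i>j)) (sym (ΔΔΩ-skew i j)))

-- The upper block evaluated on oriented edges.

module _ {c ℓ₁ ℓ₂} {F : OrderedField c ℓ₁ ℓ₂} {m} {T : MCT F (ℕ.suc m)} (ℓ : EdgeNumbering T) where
  open EdgeNumbering ℓ

  arc : Fin m → Arc (ℕ.suc m)
  arc i = orient (sgn ℓ i) (p i) (q i)

  C-pairing : ∀ i G → sum (λ r → C ℓ r i * Δ G r) ≡ ∂ (arc i) G
  C-pairing i G = signed-telescope (sgn ℓ i) (p i) (q i) G (ℕ.<⇒≤ (p<q i))

  -- `C-pairing` is applied once per factor: the inner sum turns the row index of `X` into `arc i`,
  -- the outer sum turns the column index into `arc j`.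
  exchange-form : ∀ (ε : Vec Sign (ℕ.suc m)) i j →
                  (C ℓ ᵗ ⊠ X ε ⊠ C ℓ) i j ≡ Pairing.ω (Vec.lookup ε) (arc i) (arc j)
  exchange-form ε i j = begin
    sum (λ l → sum (λ r → C ℓ r i * X ε r l) * C ℓ l j)
      ≡⟨ Sumℤ.sum-cong-≗ (λ l → cong (_* C ℓ l j) (inner l)) ⟩
    sum (λ l → Δ (λ y → ∂ (arc i) λ x → Ω x y) l * C ℓ l j)
      ≡⟨ Sumℤ.sum-cong-≗ (λ l → ℤ.*-comm _ (C ℓ l j)) ⟩
    sum (λ l → C ℓ l j * Δ (λ y → ∂ (arc i) λ x → Ω x y) l)
      ≡⟨ C-pairing j (λ y → ∂ (arc i) λ x → Ω x y) ⟩
    ∂ (arc j) (λ y → ∂ (arc i) λ x → Ω x y)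
      ≡⟨ ∂-comm (arc j) (arc i) Ω ⟩
    ω (arc i) (arc j) ∎
    where
    open Pairing (Vec.lookup ε)
    open ≡-Reasoning
    inner : ∀ l → sum (λ r → C ℓ r i * X ε r l) ≡ Δ (λ y → ∂ (arc i) λ x → Ω x y) l
    inner l = begin
      sum (λ r → C ℓ r i * X ε r l)     ≡⟨ Sumℤ.sum-cong-≗ (λ r → cong (C ℓ r i *_) (X≡ΔΔΩ ε r l)) ⟩
      sum (λ r → C ℓ r i * ΔΔΩ ε r l)   ≡⟨ C-pairing i (λ x → Δ (Ω x) l) ⟩
      ∂ (arc i) (λ x → Δ (Ω x) l)       ≡⟨ ∂-comm (arc i) (inject₁ l , suc l) (λ y x → Ω x y) ⟩
      Δ (λ y → ∂ (arc i) λ x → Ω x y) l ∎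

-- Fomin–Zelevinsky mutation

-- The correction of the mutation rule as a separate summand, 0 when the rule leaves the entry
-- alone.
increment : ℤ → ℤ → ℤ
increment a b = if does (sameSign? a b) then a * ℤ.+ ∣ b ∣ else 0ℤ

-- Magnitudes may be 0, so the hypothesis is weak opposition of signs; `SameSign` is strict and
-- fails at 0.
increment-opposite : ∀ s a b → increment (s ◃ a) (opposite s ◃ b) ≡ 0ℤ
increment-opposite Sign.+ ℕ.zero    ℕ.zero    = refl
increment-opposite Sign.+ ℕ.zero    (ℕ.suc b) = refl
increment-opposite Sign.+ (ℕ.suc a) ℕ.zero    = refl
increment-opposite Sign.+ (ℕ.suc a) (ℕ.suc b) = refl
increment-opposite Sign.- ℕ.zero    ℕ.zero    = refl
increment-opposite Sign.- ℕ.zero    (ℕ.suc b) = refl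
increment-opposite Sign.- (ℕ.suc a) ℕ.zero    = refl
increment-opposite Sign.- (ℕ.suc a) (ℕ.suc b) = refl

increment-unitʳ : ∀ s a → increment (s ◃ a) (s ◃ 1) ≡ s ◃ a
increment-unitʳ Sign.+ ℕ.zero    = refl
increment-unitʳ Sign.+ (ℕ.suc a) = ℤ.*-identityʳ _
increment-unitʳ Sign.- ℕ.zero    = refl
increment-unitʳ Sign.- (ℕ.suc a) = ℤ.*-identityʳ _

increment-unitˡ : ∀ s b → increment (s ◃ 1) (s ◃ b) ≡ s ◃ b
increment-unitˡ Sign.+ ℕ.zero    = refl
increment-unitˡ Sign.+ (ℕ.suc b) = ℤ.*-identityˡ _
increment-unitˡ Sign.- ℕ.zero    = refl
increment-unitˡ Sign.- (ℕ.suc b) = ℤ.-1*i≡-i (ℤ.+ ℕ.suc b)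

neg-opposite-◃ : ∀ s n → - (opposite s ◃ n) ≡ s ◃ n
neg-opposite-◃ Sign.+ ℕ.zero    = refl
neg-opposite-◃ Sign.+ (ℕ.suc n) = refl
neg-opposite-◃ Sign.- ℕ.zero    = refl
neg-opposite-◃ Sign.- (ℕ.suc n) = refl

mutate-unique : ∀ {m} (k : Fin m) (M M* : Matrix (m ℕ.+ m) m) →
                (∀ j → M* (k ↑ˡ m) j ≡ - M (k ↑ˡ m) j) →
                (∀ i → M* i k ≡ - M i k) →
                (∀ i j → i ≢ k ↑ˡ m → j ≢ k → M* i j ≡ M i j + increment (M i k) (M (k ↑ˡ m) j)) →
                ∀ i j → M* i j ≡ mutate k M i j
mutate-unique {m} k M M* row column off i j with i Fin.≟ k ↑ˡ m | j Fin.≟ k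
... | yes refl | _        = row j
... | no _     | yes refl = column i
... | no i≢k   | no j≢k   = trans (off i j i≢k j≢k) (if-+ (does (sameSign? (M i k) (M (k ↑ˡ m) j))))
  where
  if-+ : ∀ {x y} b → x + (if b then y else 0ℤ) ≡ (if b then x + y else x)
  if-+ true  = refl
  if-+ false = ℤ.+-identityʳ _

↑-elim : ∀ {m n} (P : Fin (m ℕ.+ n) → Set) → (∀ i → P (i ↑ˡ n)) → (∀ i → P (m ↑ʳ i)) → ∀ i → P i
↑-elim {m} {n} P upper lower i =
  subst P (Fin.join-splitAt m n i) ([_,_] {C = P ∘ Fin.join m n} upper lower (Fin.splitAt m i))

module _ {n} (ε : Fin n → Sign) where
  open Pairing ε

  module _ {e e* : Arc n} where

    -- Arcs are compared only through `∂`: each left-hand rule evaluates its hypothesis at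
    -- `λ x → ∂ f (Ω x)`, and the right-hand rules follow by skew-symmetry.
    ω-congˡ : (∀ G → ∂ e* G ≡ ∂ e G) → ∀ f → ω e* f ≡ ω e f
    ω-congˡ eq f = eq (λ x → ∂ f (Ω x))

    ω-negˡ : (∀ G → ∂ e* G ≡ - ∂ e G) → ∀ f → ω e* f ≡ - ω e f
    ω-negˡ eq f = eq (λ x → ∂ f (Ω x))

    ω-shiftˡ : ∀ {k} → (∀ G → ∂ e* G ≡ ∂ e G + ∂ k G) → ∀ f → ω e* f ≡ ω e f + ω k f
    ω-shiftˡ eq f = eq (λ x → ∂ f (Ω x))

    ω-congʳ : (∀ G → ∂ e* G ≡ ∂ e G) → ∀ f → ω f e* ≡ ω f e
    ω-congʳ eq f = trans (ω-skew f e*) (trans (cong -_ (ω-congˡ eq f)) (sym (ω-skew f e)))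

    ω-negʳ : (∀ G → ∂ e* G ≡ - ∂ e G) → ∀ f → ω f e* ≡ - ω f e
    ω-negʳ eq f = trans (ω-skew f e*) (cong -_ (trans (ω-negˡ eq f) (sym (ω-skew f e))))

    ω-shiftʳ : ∀ {k} → (∀ G → ∂ e* G ≡ ∂ e G + ∂ k G) → ∀ f → ω f e* ≡ ω f e + ω f k
    ω-shiftʳ {k} eq f = begin
      ω f e*              ≡⟨ ω-skew f e* ⟩
      - ω e* f            ≡⟨ cong -_ (ω-shiftˡ eq f) ⟩
      - (ω e f + ω k f)   ≡⟨ ℤ.neg-distrib-+ (ω e f) (ω k f) ⟩
      - ω e f + - ω k f   ≡⟨ cong₂ _+_ (ω-skew f e) (ω-skew f k) ⟨
      ω f e + ω f k       ∎
      where open ≡-Reasoning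

-- From changes of c-vectors to mutation of the exchange matrix.

module _ {c ℓ₁ ℓ₂} {F : OrderedField c ℓ₁ ℓ₂} {m} (k : Fin m)
         {T : MCT F (ℕ.suc m)} (ℓ : EdgeNumbering T)
         {T* : MCT F (ℕ.suc m)} (ℓ* : EdgeNumbering T*) where
  open Pairing (Vec.lookup (MCT.signVector T))

  -- The magnitude `n` is free and may be 0, so `fixed` records only that the entry in row `k` is
  -- zero or of sign opposite to the slope of `k`. Each constructor pairs a behaviour of the
  -- c-vector with the sign for which the mutation rule predicts it.
  data Change (j : Fin m) : Set where
    fixed   : (∀ r → C ℓ* r j ≡ C ℓ r j) →
              ∀ n → ω (arc ℓ k) (arc ℓ j) ≡ opposite (sgn ℓ k) ◃ n → Change j
    shifted : (∀ r → C ℓ* r j ≡ C ℓ r j + C ℓ r k) →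
              ω (arc ℓ k) (arc ℓ j) ≡ sgn ℓ k ◃ 1 → Change j

  C-pairing-fixed : ∀ {j} → (∀ r → C ℓ* r j ≡ C ℓ r j) →
                    ∀ G → ∂ (arc ℓ* j) G ≡ ∂ (arc ℓ j) G
  C-pairing-fixed {j} eq G = begin
    ∂ (arc ℓ* j) G                     ≡⟨ C-pairing ℓ* j G ⟨
    sum (λ r → C ℓ* r j * Δ G r)       ≡⟨ Sumℤ.sum-cong-≗ (λ r → cong (_* Δ G r) (eq r)) ⟩
    sum (λ r → C ℓ r j * Δ G r)        ≡⟨ C-pairing ℓ j G ⟩
    ∂ (arc ℓ j) G                      ∎
    where open ≡-Reasoning

  C-pairing-neg : ∀ {j} → (∀ r → C ℓ* r j ≡ - C ℓ r j) →
                  ∀ G → ∂ (arc ℓ* j) G ≡ - ∂ (arc ℓ j) G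
  C-pairing-neg {j} eq G = begin
    ∂ (arc ℓ* j) G                     ≡⟨ C-pairing ℓ* j G ⟨
    sum (λ r → C ℓ* r j * Δ G r)       ≡⟨ Sumℤ.sum-cong-≗ (λ r →
                                            trans (cong (_* Δ G r) (eq r)) (lemma (C ℓ r j) (Δ G r))) ⟩
    sum (λ r → -1ℤ * (C ℓ r j * Δ G r)) ≡⟨ Sumℤ.*-distribˡ-sum -1ℤ (λ r → C ℓ r j * Δ G r) ⟨
    -1ℤ * sum (λ r → C ℓ r j * Δ G r)  ≡⟨ cong (-1ℤ *_) (C-pairing ℓ j G) ⟩
    -1ℤ * ∂ (arc ℓ j) G                ≡⟨ ℤ.-1*i≡-i _ ⟩
    - ∂ (arc ℓ j) G                    ∎
    where
    open ≡-Reasoning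
    lemma : ∀ x y → - x * y ≡ -1ℤ * (x * y)
    lemma = solve-∀

  C-pairing-shifted : ∀ {j} → (∀ r → C ℓ* r j ≡ C ℓ r j + C ℓ r k) →
                      ∀ G → ∂ (arc ℓ* j) G ≡ ∂ (arc ℓ j) G + ∂ (arc ℓ k) G
  C-pairing-shifted {j} eq G = begin
    ∂ (arc ℓ* j) G                     ≡⟨ C-pairing ℓ* j G ⟨
    sum (λ r → C ℓ* r j * Δ G r)       ≡⟨ Sumℤ.sum-cong-≗ (λ r → trans (cong (_* Δ G r) (eq r))
                                            (ℤ.*-distribʳ-+ (Δ G r) (C ℓ r j) (C ℓ r k))) ⟩
    sum (λ r → C ℓ r j * Δ G r + C ℓ r k * Δ G r)
                                       ≡⟨ Sumℤ.∑-distrib-+ (λ r → C ℓ r j * Δ G r) (λ r → C ℓ r k * Δ G r) ⟩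
    sum (λ r → C ℓ r j * Δ G r) + sum (λ r → C ℓ r k * Δ G r)
                                       ≡⟨ cong₂ _+_ (C-pairing ℓ j G) (C-pairing ℓ k G) ⟩
    ∂ (arc ℓ j) G + ∂ (arc ℓ k) G      ∎
    where open ≡-Reasoning

  private
    ε = Vec.lookup (MCT.signVector T)
    b : Fin m → Fin m → ℤ
    b i j = ω (arc ℓ i) (arc ℓ j)
    b* : Fin m → Fin m → ℤ
    b* i j = ω (arc ℓ* i) (arc ℓ* j)
    s = sgn ℓ k

  b-ik-stays : ∀ {i n} → b k i ≡ opposite s ◃ n → b i k ≡ s ◃ n
  b-ik-stays {i} {n} eq = begin
    b i k               ≡⟨ ω-skew (arc ℓ i) (arc ℓ k) ⟩
    - b k i             ≡⟨ cong -_ eq ⟩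
    - (opposite s ◃ n)  ≡⟨ neg-opposite-◃ s n ⟩
    s ◃ n               ∎
    where open ≡-Reasoning

  b-ik-moves : ∀ {i n} → b k i ≡ s ◃ n → b i k ≡ opposite s ◃ n
  b-ik-moves {i} {n} eq = begin
    b i k                          ≡⟨ ω-skew (arc ℓ i) (arc ℓ k) ⟩
    - b k i                        ≡⟨ cong -_ eq ⟩
    - (s ◃ n)                      ≡⟨ cong -_ (neg-opposite-◃ s n) ⟨
    - - (opposite s ◃ n)           ≡⟨ ℤ.neg-involutive (opposite s ◃ n) ⟩
    opposite s ◃ n                 ∎
    where open ≡-Reasoning

  -- Two fixed edges make the signs of `b i k` and `b k j` weakly opposite, hence no increment. If
  -- exactly one is shifted, the signs agree weakly, one factor is a unit, and the increment is the
  -- term added by the shift. If both are shifted, `b i k` and `b k j` cancel and `b k k` is 0.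
  b-off : ∀ {i j} → Change i → Change j → b* i j ≡ b i j + increment (b i k) (b k j)
  b-off {i} {j} (fixed eᵢ n bᵢ) (fixed eⱼ n′ bⱼ) = begin
    b* i j                                      ≡⟨ ω-congˡ ε {arc ℓ i} (C-pairing-fixed eᵢ) (arc ℓ* j) ⟩
    ω (arc ℓ i) (arc ℓ* j)                      ≡⟨ ω-congʳ ε {arc ℓ j} (C-pairing-fixed eⱼ) (arc ℓ i) ⟩
    b i j                                       ≡⟨ ℤ.+-identityʳ (b i j) ⟨
    b i j + 0ℤ                                  ≡⟨ cong (b i j +_) (increment-opposite s n n′) ⟨
    b i j + increment (s ◃ n) (opposite s ◃ n′) ≡⟨ cong₂ (λ x y → b i j + increment x y) (b-ik-stays bᵢ) bⱼ ⟨
    b i j + increment (b i k) (b k j)           ∎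
    where open ≡-Reasoning
  b-off {i} {j} (fixed eᵢ n bᵢ) (shifted eⱼ bⱼ) = begin
    b* i j                                      ≡⟨ ω-congˡ ε {arc ℓ i} (C-pairing-fixed eᵢ) (arc ℓ* j) ⟩
    ω (arc ℓ i) (arc ℓ* j)                      ≡⟨ ω-shiftʳ ε {arc ℓ j} (C-pairing-shifted eⱼ) (arc ℓ i) ⟩
    b i j + b i k                               ≡⟨ cong (b i j +_) (b-ik-stays bᵢ) ⟩
    b i j + (s ◃ n)                             ≡⟨ cong (b i j +_) (increment-unitʳ s n) ⟨
    b i j + increment (s ◃ n) (s ◃ 1)           ≡⟨ cong₂ (λ x y → b i j + increment x y) (b-ik-stays bᵢ) bⱼ ⟨
    b i j + increment (b i k) (b k j)           ∎
    where open ≡-Reasoning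
  b-off {i} {j} (shifted eᵢ bᵢ) (fixed eⱼ n bⱼ) = begin
    b* i j                                      ≡⟨ ω-congʳ ε {arc ℓ j} (C-pairing-fixed eⱼ) (arc ℓ* i) ⟩
    ω (arc ℓ* i) (arc ℓ j)                      ≡⟨ ω-shiftˡ ε {arc ℓ i} (C-pairing-shifted eᵢ) (arc ℓ j) ⟩
    b i j + b k j                               ≡⟨ cong (b i j +_) bⱼ ⟩
    b i j + (opposite s ◃ n)                    ≡⟨ cong (b i j +_) (increment-unitˡ (opposite s) n) ⟨
    b i j + increment (opposite s ◃ 1) (opposite s ◃ n)
                                                ≡⟨ cong₂ (λ x y → b i j + increment x y) (b-ik-moves bᵢ) bⱼ ⟨
    b i j + increment (b i k) (b k j)           ∎
    where open ≡-Reasoning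
  b-off {i} {j} (shifted eᵢ bᵢ) (shifted eⱼ bⱼ) = begin
    b* i j                                      ≡⟨ ω-shiftˡ ε {arc ℓ i} (C-pairing-shifted eᵢ) (arc ℓ* j) ⟩
    ω (arc ℓ i) (arc ℓ* j) + ω (arc ℓ k) (arc ℓ* j)
      ≡⟨ cong₂ _+_ (ω-shiftʳ ε {arc ℓ j} (C-pairing-shifted eⱼ) (arc ℓ i))
                   (ω-shiftʳ ε {arc ℓ j} (C-pairing-shifted eⱼ) (arc ℓ k)) ⟩
    (b i j + b i k) + (b k j + b k k)
      ≡⟨ cong₂ (λ x y → (b i j + x) + (y + b k k)) (b-ik-moves bᵢ) bⱼ ⟩
    (b i j + (opposite s ◃ 1)) + ((s ◃ 1) + b k k)
      ≡⟨ cong (λ x → (b i j + (opposite s ◃ 1)) + ((s ◃ 1) + x)) (ω-alternating (arc ℓ k)) ⟩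
    (b i j + (opposite s ◃ 1)) + ((s ◃ 1) + 0ℤ) ≡⟨ cancel (b i j) s ⟩
    b i j + increment (opposite s ◃ 1) (s ◃ 1)  ≡⟨ cong₂ (λ x y → b i j + increment x y) (b-ik-moves bᵢ) bⱼ ⟨
    b i j + increment (b i k) (b k j)           ∎
    where
    open ≡-Reasoning
    cancel : ∀ x s → (x + (opposite s ◃ 1)) + ((s ◃ 1) + 0ℤ) ≡ x + increment (opposite s ◃ 1) (s ◃ 1)
    cancel x Sign.+ = ℤ.+-assoc x -1ℤ 1ℤ
    cancel x Sign.- = ℤ.+-assoc x 1ℤ -1ℤ

  -- Every nonzero entry in column `k` of `C` has the sign `s`. A `b k j` that is zero or of the
  -- opposite sign gives no increment, and `s ◃ 1` gives the entry itself.
  C-off : ∀ {j} → Change j → ∀ r → C ℓ* r j ≡ C ℓ r j + increment (C ℓ r k) (b k j)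
  C-off {j} (fixed eⱼ n bⱼ) r = begin
    C ℓ* r j                                        ≡⟨ eⱼ r ⟩
    C ℓ r j                                         ≡⟨ ℤ.+-identityʳ (C ℓ r j) ⟨
    C ℓ r j + 0ℤ
      ≡⟨ cong (C ℓ r j +_) (increment-opposite s (indicator p q r) n) ⟨
    C ℓ r j + increment (C ℓ r k) (opposite s ◃ n)  ≡⟨ cong (λ z → C ℓ r j + increment (C ℓ r k) z) bⱼ ⟨
    C ℓ r j + increment (C ℓ r k) (b k j)           ∎
    where
    open ≡-Reasoning
    p = EdgeNumbering.p ℓ k
    q = EdgeNumbering.q ℓ k
  C-off {j} (shifted eⱼ bⱼ) r = begin
    C ℓ* r j                                        ≡⟨ eⱼ r ⟩
    C ℓ r j + C ℓ r k
      ≡⟨ cong (C ℓ r j +_) (increment-unitʳ s (indicator p q r)) ⟨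
    C ℓ r j + increment (C ℓ r k) (s ◃ 1)           ≡⟨ cong (λ z → C ℓ r j + increment (C ℓ r k) z) bⱼ ⟨
    C ℓ r j + increment (C ℓ r k) (b k j)           ∎
    where
    open ≡-Reasoning
    p = EdgeNumbering.p ℓ k
    q = EdgeNumbering.q ℓ k

  module _ (signs : MCT.signVector T* ≡ MCT.signVector T)
           (c-k : ∀ r → C ℓ* r k ≡ - C ℓ r k)
           (change : ∀ j → j ≢ k → Change j) where

    -- Reversing `k` negates the row. Changing the second arc has no effect on it, because a shift
    -- adds only `b k k`, which is 0.
    row-k : ∀ j → b* k j ≡ - b k j
    row-k j = trans (ω-negˡ ε {arc ℓ k} (C-pairing-neg c-k) (arc ℓ* j)) (cong -_ column)
      where
      column : ω (arc ℓ k) (arc ℓ* j) ≡ b k j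
      column with j Fin.≟ k
      ... | yes refl = trans (ω-negʳ ε {arc ℓ k} (C-pairing-neg c-k) (arc ℓ k))
        (trans (cong -_ (ω-alternating (arc ℓ k))) (sym (ω-alternating (arc ℓ k))))
      ... | no j≢k with change j j≢k
      ...   | fixed eⱼ _ _ = ω-congʳ ε {arc ℓ j} (C-pairing-fixed eⱼ) (arc ℓ k)
      ...   | shifted eⱼ _ = trans (ω-shiftʳ ε {arc ℓ j} (C-pairing-shifted eⱼ) (arc ℓ k))
        (trans (cong (b k j +_) (ω-alternating (arc ℓ k))) (ℤ.+-identityʳ (b k j)))

    column-k : ∀ i → b* i k ≡ - b i k
    column-k i = trans (ω-skew (arc ℓ* i) (arc ℓ* k))
      (cong -_ (trans (row-k i) (sym (ω-skew (arc ℓ i) (arc ℓ k)))))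

    upper : ∀ i j → exchangeMatrix ℓ (i ↑ˡ m) j ≡ b i j
    upper i j = trans (cong (λ row → row j) (lookup-++ˡ (C ℓ ᵗ ⊠ X (MCT.signVector T) ⊠ C ℓ) (C ℓ) i))
                  (exchange-form ℓ (MCT.signVector T) i j)

    upper* : ∀ i j → exchangeMatrix ℓ* (i ↑ˡ m) j ≡ b* i j
    upper* i j = trans (cong (λ row → row j) (lookup-++ˡ (C ℓ* ᵗ ⊠ X (MCT.signVector T*) ⊠ C ℓ*) (C ℓ*) i))
                   (trans (exchange-form ℓ* (MCT.signVector T*) i j)
                          (cong (λ v → Pairing.ω (Vec.lookup v) (arc ℓ* i) (arc ℓ* j)) signs))

    lower : ∀ i j → exchangeMatrix ℓ (m ↑ʳ i) j ≡ C ℓ i j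
    lower i j = cong (λ row → row j) (lookup-++ʳ (C ℓ ᵗ ⊠ X (MCT.signVector T) ⊠ C ℓ) (C ℓ) i)

    lower* : ∀ i j → exchangeMatrix ℓ* (m ↑ʳ i) j ≡ C ℓ* i j
    lower* i j = cong (λ row → row j) (lookup-++ʳ (C ℓ* ᵗ ⊠ X (MCT.signVector T*) ⊠ C ℓ*) (C ℓ*) i)

    exchangeMatrix-mutates : ∀ i j → exchangeMatrix ℓ* i j ≡ mutate k (exchangeMatrix ℓ) i j
    exchangeMatrix-mutates = mutate-unique k (exchangeMatrix ℓ) (exchangeMatrix ℓ*)
      (λ j → trans (upper* k j) (trans (row-k j) (cong -_ (sym (upper k j)))))
      (↑-elim (λ i → exchangeMatrix ℓ* i k ≡ - exchangeMatrix ℓ i k)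
        (λ i → trans (upper* i k) (trans (column-k i) (cong -_ (sym (upper i k)))))
        (λ i → trans (lower* i k) (trans (c-k i) (cong -_ (sym (lower i k))))))
      (λ i j i≢k j≢k → ↑-elim
        (λ i → i ≢ k ↑ˡ m → exchangeMatrix ℓ* i j ≡
               exchangeMatrix ℓ i j + increment (exchangeMatrix ℓ i k) (exchangeMatrix ℓ (k ↑ˡ m) j))
        (λ i i≢k → trans (upper* i j) (trans (b-off (change i (i≢k ∘ cong (_↑ˡ m))) (change j j≢k))
          (cong₂ _+_ (sym (upper i j)) (cong₂ increment (sym (upper i k)) (sym (upper k j))))))
        (λ i _ → trans (lower* i j) (trans (C-off (change j j≢k) i)
          (cong₂ _+_ (sym (lower i j)) (cong₂ increment (sym (lower i k)) (sym (upper k j))))))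
        i i≢k)

-- Endpoints of mutated edges

-- Test functions: `∂` at `δ w` counts `w` as a tail minus `w` as a head, which recovers the ends of
-- an arc from its functional.
δ : ∀ {n} → Fin n → Fin n → ℤ
δ a x = if does (a Fin.≟ x) then 1ℤ else 0ℤ

δ-same : ∀ {n} (a : Fin n) → δ a a ≡ 1ℤ
δ-same a = cong (if_then 1ℤ else 0ℤ) (dec-true (a Fin.≟ a) refl)

δ-diff : ∀ {n} {a x : Fin n} → a ≢ x → δ a x ≡ 0ℤ
δ-diff {a = a} {x} a≢x = cong (if_then 1ℤ else 0ℤ) (dec-false (a Fin.≟ x) a≢x)

δ-bit : ∀ {n} (a x : Fin n) → δ a x ≡ 0ℤ ⊎ δ a x ≡ 1ℤ
δ-bit a x with does (a Fin.≟ x)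
... | true  = inj₂ refl
... | false = inj₁ refl

separated : ∀ {n} {a b : Fin n} → (∀ (G : Fin n → ℤ) → G a ≡ G b) → a ≡ b
separated {a = a} {b} eq with a Fin.≟ b
... | yes a≡b = a≡b
... | no a≢b with () ← trans (sym (δ-same a)) (trans (eq (δ a)) (δ-diff a≢b))

∂-tail : ∀ {n} {a b : Fin n} → a ≢ b → ∂ (a , b) (δ a) ≡ 1ℤ
∂-tail {a = a} a≢b = cong₂ _-_ (δ-same a) (δ-diff a≢b)

∂-head : ∀ {n} {a b : Fin n} → a ≢ b → ∂ (a , b) (δ b) ≡ -1ℤ
∂-head {b = b} a≢b = cong₂ _-_ (δ-diff (a≢b ∘ sym)) (δ-same b)

-- If `w` is neither tail, the tail terms vanish and the head terms contribute at most 0, so the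
-- total cannot be 1.
tail-match : ∀ {n} {w a b c d : Fin n} → ∂ (a , b) (δ w) + ∂ (c , d) (δ w) ≡ 1ℤ → w ≡ a ⊎ w ≡ c
tail-match {w = w} {a} {b} {c} {d} eq with w Fin.≟ a | w Fin.≟ c
... | yes p | _     = inj₁ p
... | no _  | yes q = inj₂ q
... | no p  | no q
  with δ w a | δ-diff p | δ w c | δ-diff q | δ w b | δ-bit w b | δ w d | δ-bit w d
...   | _ | refl | _ | refl | _ | inj₁ refl | _ | inj₁ refl with () ← eq
...   | _ | refl | _ | refl | _ | inj₁ refl | _ | inj₂ refl with () ← eq
...   | _ | refl | _ | refl | _ | inj₂ refl | _ | inj₁ refl with () ← eq
...   | _ | refl | _ | refl | _ | inj₂ refl | _ | inj₂ refl with () ← eq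

head-match : ∀ {n} {w a b c d : Fin n} → ∂ (a , b) (δ w) + ∂ (c , d) (δ w) ≡ -1ℤ → w ≡ b ⊎ w ≡ d
head-match {w = w} {a} {b} {c} {d} eq with w Fin.≟ b | w Fin.≟ d
... | yes p | _     = inj₁ p
... | no _  | yes q = inj₂ q
... | no p  | no q
  with δ w b | δ-diff p | δ w d | δ-diff q | δ w a | δ-bit w a | δ w c | δ-bit w c
...   | _ | refl | _ | refl | _ | inj₁ refl | _ | inj₁ refl with () ← eq
...   | _ | refl | _ | refl | _ | inj₁ refl | _ | inj₂ refl with () ← eq
...   | _ | refl | _ | refl | _ | inj₂ refl | _ | inj₁ refl with () ← eq
...   | _ | refl | _ | refl | _ | inj₂ refl | _ | inj₂ refl with () ← eq

∂-injective : ∀ {n} {e e′ : Arc n} → proj₁ e ≢ proj₂ e → (∀ G → ∂ e G ≡ ∂ e′ G) → e ≡ e′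
∂-injective {e = a , b} {c , d} a≢b eq = cong₂ _,_
  (Sum.reduce
    -- The loop `(c , c)` contributes 0 and lets the lemma on two arcs serve for one.
    (tail-match {w = a} {c} {d} {c} {c}
      (trans (add-loop (δ a c) (δ a d) (δ a c)) (trans (sym (eq (δ a))) (∂-tail a≢b)))))
  (Sum.reduce
    (head-match {w = b} {c} {d} {d} {d}
      (trans (add-loop (δ b c) (δ b d) (δ b d)) (trans (sym (eq (δ b))) (∂-head a≢b)))))
  where
  add-loop : ∀ x y z → (x - y) + (z - z) ≡ x - y
  add-loop = solve-∀

cancel : ∀ {u v p q} → p ≡ q → u - v ≡ p - q → u ≡ v
cancel p≡q eq = ℤ.i-j≡0⇒i≡j _ _ (trans eq (ℤ.i≡j⇒i-j≡0 p≡q))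

-- Tail and head of the sum are found among the tails and heads of the summands. If one summand
-- supplied both, the other would have zero functional and be a loop; otherwise the remaining two
-- ends cancel and coincide.
∂-composite : ∀ {n} {a b c d e f : Fin n} → a ≢ b → c ≢ d → e ≢ f →
              (∀ G → ∂ (a , b) G ≡ ∂ (c , d) G + ∂ (e , f) G) →
              (d ≡ e × a ≡ c × b ≡ f) ⊎ (f ≡ c × a ≡ e × b ≡ d)
∂-composite {a = a} {b} {c} {d} {e} {f} a≢b c≢d e≢f eq
  with tail-match {w = a} {c} {d} {e} {f} (trans (sym (eq (δ a))) (∂-tail a≢b))
     | head-match {w = b} {c} {d} {e} {f} (trans (sym (eq (δ b))) (∂-head a≢b))
... | inj₁ refl | inj₁ refl =
  contradiction (separated λ G → cancel (sym (eq G)) (lemma (G c) (G d) (G e) (G f))) e≢f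
  where
  lemma : ∀ u v x y → x - y ≡ ((u - v) + (x - y)) - (u - v)
  lemma = solve-∀
... | inj₁ refl | inj₂ refl =
  inj₁ (separated (λ G → cancel (eq G) (lemma (G c) (G d) (G e) (G f))) , refl , refl)
  where
  lemma : ∀ u v x y → v - x ≡ (u - y) - ((u - v) + (x - y))
  lemma = solve-∀
... | inj₂ refl | inj₁ refl =
  inj₂ (separated (λ G → cancel (eq G) (lemma (G c) (G d) (G e) (G f))) , refl , refl)
  where
  lemma : ∀ u v x y → y - u ≡ (x - v) - ((u - v) + (x - y))
  lemma = solve-∀
... | inj₂ refl | inj₂ refl =
  contradiction (separated λ G → cancel (sym (eq G)) (lemma (G c) (G d) (G e) (G f))) c≢d
  where
  lemma : ∀ u v x y → u - v ≡ ((u - v) + (x - y)) - (x - y)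
  lemma = solve-∀

-- Three nodes and the sign of their median.

module _ {n} (ε : Fin n → Sign) where
  open Pairing ε

  cyc : Fin n → Fin n → Fin n → ℤ
  cyc x y z = Ω x y + Ω y z + Ω z x

  cyc-rotate : ∀ x y z → cyc x y z ≡ cyc y z x
  cyc-rotate x y z = lemma (Ω x y) (Ω y z) (Ω z x)
    where
    lemma : ∀ a b c → a + b + c ≡ b + c + a
    lemma = solve-∀

  turn : ∀ {m x y : Fin n} → Between m x y → Sign → Sign
  turn (inj₁ _) = opposite
  turn (inj₂ _) s = s

  -- The two terms containing the largest node cancel; in the third the larger argument is the
  -- median.
  cyc-between : ∀ {m x y s} (bt : Between m x y) → ε m ≡ s → cyc m x y ≡ turn bt s ◃ 1
  cyc-between {m} {x} {y} {s} (inj₁ (x<m , m<y)) refl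
    rewrite Ω-> x<m | Ω-< (ℕ.<-trans x<m m<y) | Ω-> m<y = trans (lemma ⟦ m ⟧ ⟦ y ⟧) (negate (ε m))
    where
    lemma : ∀ a b → - a + b + - b ≡ - a
    lemma = solve-∀
    negate : ∀ s → - (s ◃ 1) ≡ opposite s ◃ 1
    negate Sign.+ = refl
    negate Sign.- = refl
  cyc-between {m} {x} {y} {s} (inj₂ (y<m , m<x)) refl
    rewrite Ω-< m<x | Ω-> (ℕ.<-trans y<m m<x) | Ω-< y<m = lemma ⟦ m ⟧ ⟦ x ⟧
    where
    lemma : ∀ a b → b + - b + a ≡ a
    lemma = solve-∀

  -- The diagonal value vanishes and skew-symmetry makes the other three a cyclic sum. Reversing one
  -- of the arcs exchanges `a` and `b` in it.
  ω-out-out : ∀ w a b → ω (w , a) (w , b) ≡ cyc w a b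
  ω-out-out w a b rewrite Ω-diag w | Ω-skew a w | Ω-skew w b = lemma (Ω w a) (Ω b w) (Ω a b)
    where
    lemma : ∀ x y z → (0ℤ - - y) - (- x - z) ≡ x + z + y
    lemma = solve-∀

  ω-in-in : ∀ w a b → ω (a , w) (b , w) ≡ cyc w a b
  ω-in-in w a b rewrite Ω-diag w | Ω-skew a w | Ω-skew w b = lemma (Ω w a) (Ω b w) (Ω a b)
    where
    lemma : ∀ x y z → (z - - x) - (- y - 0ℤ) ≡ x + z + y
    lemma = solve-∀

  ω-out-in : ∀ w a b → ω (w , a) (b , w) ≡ cyc w b a
  ω-out-in w a b rewrite Ω-diag w | Ω-skew a b = lemma (Ω w b) (Ω b a) (Ω a w)
    where
    lemma : ∀ x y z → (x - 0ℤ) - (- y - z) ≡ x + y + z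
    lemma = solve-∀

  ω-in-out : ∀ w a b → ω (a , w) (w , b) ≡ cyc w b a
  ω-in-out w a b rewrite Ω-diag w | Ω-skew a b = lemma (Ω w b) (Ω b a) (Ω a w)
    where
    lemma : ∀ x y z → (z - - y) - (0ℤ - x) ≡ x + y + z
    lemma = solve-∀

-- The alternatives are cyclic rotations of one another, so `cyc-rotate` brings whichever node is
-- the median to the first place.
some-between : ∀ {n} {a b c : Fin n} → a ≢ b → a ≢ c → b ≢ c →
               Between a b c ⊎ Between b c a ⊎ Between c a b
some-between {a = a} {b} {c} a≢b a≢c b≢c with Fin.<-cmp a b | Fin.<-cmp b c | Fin.<-cmp a c
... | tri≈ _ p _   | _            | _            = contradiction p a≢b
... | _            | tri≈ _ p _   | _            = contradiction p b≢c
... | _            | _            | tri≈ _ p _   = contradiction p a≢c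
... | tri< a<b _ _ | tri< b<c _ _ | _            = inj₂ (inj₁ (inj₂ (a<b , b<c)))
... | tri< a<b _ _ | tri> _ _ c<b | tri< a<c _ _ = inj₂ (inj₂ (inj₁ (a<c , c<b)))
... | tri< a<b _ _ | tri> _ _ c<b | tri> _ _ c<a = inj₁ (inj₂ (c<a , a<b))
... | tri> _ _ b<a | tri< b<c _ _ | tri< a<c _ _ = inj₁ (inj₁ (b<a , a<c))
... | tri> _ _ b<a | tri< b<c _ _ | tri> _ _ c<a = inj₂ (inj₂ (inj₂ (b<c , c<a)))
... | tri> _ _ b<a | tri> _ _ c<b | _            = inj₂ (inj₁ (inj₁ (c<b , b<a)))

-- For an arc pointing upwards, `s` is the sign of its slope.
Oriented : ∀ {n} → Sign → Fin n → Fin n → Set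
Oriented s a b = (s ≡ Sign.+ × a Fin.< b) ⊎ (s ≡ Sign.- × b Fin.< a)

rightward : ∀ {n s} {a b : Fin n} → Oriented s a b → a Fin.< b → s ≡ Sign.+
rightward (inj₁ (s≡+ , _)) _   = s≡+
rightward (inj₂ (_ , b<a)) a<b = contradiction b<a (ℕ.<-asym a<b)

leftward : ∀ {n s} {a b : Fin n} → Oriented s a b → b Fin.< a → s ≡ Sign.-
leftward (inj₁ (_ , a<b)) b<a = contradiction b<a (ℕ.<-asym a<b)
leftward (inj₂ (s≡- , _)) _   = s≡-

orient-injective : ∀ {n s s′} {a b c d : Fin n} → a Fin.< b → c Fin.< d →
                   orient s a b ≡ orient s′ c d → a ≡ c × b ≡ d
orient-injective {s = Sign.+} {Sign.+} _   _   refl = refl , refl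
orient-injective {s = Sign.+} {Sign.-} a<b c<d refl = contradiction c<d (ℕ.<-asym a<b)
orient-injective {s = Sign.-} {Sign.+} a<b c<d refl = contradiction c<d (ℕ.<-asym a<b)
orient-injective {s = Sign.-} {Sign.-} _   _   refl = refl , refl

-- Rising edges, and the vanishing of the form on disjoint edges.

module Rising {c ℓ₁ ℓ₂} {F : OrderedField c ℓ₁ ℓ₂} {n} (T : MCT F n) where
  open OrderedField F using (_<_; reflexive; compare)
  open OrderedFieldProperties F
  open Geometry T public
  open MCT T using (adj-sym)

  Up : Fin n → Fin n → Set ℓ₂
  Up a b = Edge a b × yₜ a < yₜ b

  Rises : Arc n → Set ℓ₂
  Rises (a , b) = Up a b

  Up⇒≢ : ∀ {a b} → Up a b → a ≢ b
  Up⇒≢ (_ , ya<yb) a≡b = <-irrefl (reflexive (cong yₜ a≡b)) ya<yb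

  Up-asym : ∀ {a b} → Up a b → ¬ Up b a
  Up-asym (_ , ya<yb) (_ , yb<ya) = <-asym ya<yb yb<ya

  up-up : ∀ {m a b} → Up m a → Up m b → a ≢ b → ε m ≡ Sign.- × Between m a b
  up-up (ma , m<a) (mb , m<b) = two-parents ma mb m<a m<b

  down-down : ∀ {m a b} → Up a m → Up b m → a ≢ b → ε m ≡ Sign.+ × Between m a b
  down-down (am , a<m) (bm , b<m) = two-children (adj-sym am) (adj-sym bm) a<m b<m

  above-edge : ∀ {a b m} → Up a b → Between m a b → yₜ b < yₜ m → ε m ≡ Sign.-
  above-edge (ab , a<b) m∈ab b<m = peak ab m∈ab (<-trans a<b b<m) b<m

  below-edge : ∀ {a b m} → Up a b → Between m a b → yₜ m < yₜ a → ε m ≡ Sign.+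
  below-edge (ab , a<b) m∈ab m<a = valley ab m∈ab m<a (<-trans m<a a<b)

  open Pairing ε

  ω-flipˡ : ∀ a b e → ω (b , a) e ≡ - ω (a , b) e
  ω-flipˡ a b e = lemma (∂ e (Ω a)) (∂ e (Ω b))
    where
    lemma : ∀ x y → y - x ≡ - (x - y)
    lemma = solve-∀

  -- If `b` is left of `c`, `Ω` does not distinguish `a` from `b`. Overlapping intervals have
  -- opposite signs at `b` and `c`, so `Ω b c = Ω a c`. Nested ones have equal signs at `c` and `d`,
  -- so both inner differences vanish.
  ω-disjoint-ordered : ∀ {a b c d} → Edge a b → Edge c d → a ≢ d → b ≢ c → b ≢ d →
                       a Fin.< b → c Fin.< d → a Fin.< c → ω (a , b) (c , d) ≡ 0ℤ
  ω-disjoint-ordered {a} {b} {c} {d} ab cd a≢d b≢c b≢d a<b c<d a<c with ℕ.<-cmp (toℕ b) (toℕ c)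
  ... | tri< b<c _ _ rewrite Ω-< a<c | Ω-< b<c | Ω-< (ℕ.<-trans a<c c<d) | Ω-< (ℕ.<-trans b<c c<d) =
    ℤ.+-inverseʳ (⟦ c ⟧ - ⟦ d ⟧)
  ... | tri≈ _ b≡c _ = contradiction (Fin.toℕ-injective b≡c) b≢c
  ... | tri> _ _ c<b with ℕ.<-cmp (toℕ b) (toℕ d)
  ...   | tri< b<d _ _ rewrite Ω-< a<c | Ω-> c<b | Ω-< (ℕ.<-trans a<c c<d) | Ω-< b<d
      | Disjoint.overlapping ab cd (λ { refl → ℕ.<-irrefl refl a<c }) a≢d b≢c b≢d a<c c<b b<d =
    lemma (ε c) ⟦ d ⟧
    where
    lemma : ∀ s x → ((s ◃ 1) - x) - (- (opposite s ◃ 1) - x) ≡ 0ℤ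
    lemma Sign.+ = solve-∀
    lemma Sign.- = solve-∀
  ...   | tri≈ _ b≡d _ = contradiction (Fin.toℕ-injective b≡d) b≢d
  ...   | tri> _ _ d<b rewrite Ω-< a<c | Ω-> c<b | Ω-< (ℕ.<-trans a<c c<d) | Ω-> d<b
      | Disjoint.nested ab cd (λ { refl → ℕ.<-irrefl refl a<c }) a≢d b≢c b≢d a<c c<d d<b =
    lemma ⟦ b ⟧ ⟦ c ⟧
    where
    lemma : ∀ x y → (y - y) - (- x - - x) ≡ 0ℤ
    lemma = solve-∀

  private
    ω-disjoint-rightward : ∀ {a b c d} → Edge a b → Edge c d → a ≢ c → a ≢ d → b ≢ c → b ≢ d →
                           a Fin.< b → c Fin.< d → ω (a , b) (c , d) ≡ 0ℤ
    ω-disjoint-rightward {a} {b} {c} {d} ab cd a≢c a≢d b≢c b≢d a<b c<d with ℕ.<-cmp (toℕ a) (toℕ c)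
    ... | tri< a<c _ _ = ω-disjoint-ordered ab cd a≢d b≢c b≢d a<b c<d a<c
    ... | tri≈ _ a≡c _ = contradiction (Fin.toℕ-injective a≡c) a≢c
    ... | tri> _ _ c<a = trans (ω-skew (a , b) (c , d))
      (cong -_ (ω-disjoint-ordered cd ab (b≢c ∘ sym) (a≢d ∘ sym) (b≢d ∘ sym) c<d a<b c<a))

    ω-disjoint-rightwardˡ : ∀ {a b c d} → Edge a b → Edge c d → a ≢ b → a ≢ c → a ≢ d → b ≢ c → b ≢ d →
                            c Fin.< d → ω (a , b) (c , d) ≡ 0ℤ
    ω-disjoint-rightwardˡ {a} {b} {c} {d} ab cd a≢b a≢c a≢d b≢c b≢d c<d with ℕ.<-cmp (toℕ a) (toℕ b)
    ... | tri< a<b _ _ = ω-disjoint-rightward ab cd a≢c a≢d b≢c b≢d a<b c<d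
    ... | tri≈ _ a≡b _ = contradiction (Fin.toℕ-injective a≡b) a≢b
    ... | tri> _ _ b<a = trans (ω-flipˡ b a (c , d))
      (cong -_ (ω-disjoint-rightward (adj-sym ab) cd b≢c b≢d a≢c a≢d b<a c<d))

  -- Reversing an arc changes only the sign, so both may run from left to right, and skew-symmetry
  -- orders their left ends.
  ω-disjoint : ∀ {a b c d} → Edge a b → Edge c d → a ≢ b → c ≢ d → a ≢ c → a ≢ d → b ≢ c → b ≢ d →
               ω (a , b) (c , d) ≡ 0ℤ
  ω-disjoint {a} {b} {c} {d} ab cd a≢b c≢d a≢c a≢d b≢c b≢d with ℕ.<-cmp (toℕ c) (toℕ d)
  ... | tri< c<d _ _ = ω-disjoint-rightwardˡ ab cd a≢b a≢c a≢d b≢c b≢d c<d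
  ... | tri≈ _ c≡d _ = contradiction (Fin.toℕ-injective c≡d) c≢d
  ... | tri> _ _ d<c = trans (ω-skew (a , b) (c , d)) (cong -_ (trans (ω-flipˡ d c (a , b))
      (cong -_ (trans (ω-skew (d , c) (a , b))
        (cong -_ (ω-disjoint-rightwardˡ ab (adj-sym cd) a≢b a≢d a≢c b≢d b≢c d<c))))))

module _ {c ℓ₁ ℓ₂} {F : OrderedField c ℓ₁ ℓ₂} {m} {T : MCT F (ℕ.suc m)} (ℓ : EdgeNumbering T) where
  open OrderedField F using (_<_; _<?_; compare)
  open Rising T
  open MCT T using (adj-sym; no-horizontal)
  open EdgeNumbering ℓ

  arc-rises-oriented : ∀ i → Rises (arc ℓ i) × Oriented (sgn ℓ i) (proj₁ (arc ℓ i)) (proj₂ (arc ℓ i))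
  arc-rises-oriented i = by-slope (yₜ (p i) <? yₜ (q i))
    where
    sign : Dec (yₜ (p i) < yₜ (q i)) → Sign
    sign d = if does d then Sign.+ else Sign.-
    -- Generalising over the decision lets the sign and the orientation of the arc reduce together.
    by-slope : ∀ d → let e = orient (sign d) (p i) (q i) in Rises e × Oriented (sign d) (proj₁ e) (proj₂ e)
    by-slope (yes up) = (edge i , up) , inj₁ (refl , p<q i)
    by-slope (no ¬up) with compare (yₜ (p i)) (yₜ (q i))
    ... | tri< up _ _   = contradiction up ¬up
    ... | tri≈ _ flat _ = contradiction flat (no-horizontal (edge i))
    ... | tri> _ _ down = (adj-sym (edge i) , down) , inj₂ (refl , p<q i)

  arc-rises : ∀ i → Rises (arc ℓ i)
  arc-rises i = proj₁ (arc-rises-oriented i)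

  arc-oriented : ∀ i → Oriented (sgn ℓ i) (proj₁ (arc ℓ i)) (proj₂ (arc ℓ i))
  arc-oriented i = proj₂ (arc-rises-oriented i)

  arc-injective : ∀ {i j} → arc ℓ i ≡ arc ℓ j → i ≡ j
  arc-injective {i} {j} eq with orient-injective {s = sgn ℓ i} {sgn ℓ j} (p<q i) (p<q j) eq
  ... | pᵢ≡pⱼ , qᵢ≡qⱼ = injective pᵢ≡pⱼ qᵢ≡qⱼ

-- Comparison of `T` with `T*`.

module _ {c ℓ₁ ℓ₂} {F : OrderedField c ℓ₁ ℓ₂} {n} {T T* : MCT F n}
         (signs : MCT.signVector T* ≡ MCT.signVector T) where
  private
    module T  = Rising T
    module T* = Rising T*
  open Pairing T.ε

  private
    ε*≡ε : ∀ i {s} → T*.ε i ≡ s → T.ε i ≡ s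
    ε*≡ε i = trans (sym (cong (λ v → Vec.lookup v i) signs))

  -- The middle one of the three nodes w, a, b lies above or below the edge of T
  -- or of T* joining the other two, which fixes its sign.
  shifted-above : ∀ {w a b s} → Oriented s w a → T.Up w a → T.Up b w → T*.Up a w → T*.Up b a →
                  ω (w , a) (b , w) ≡ s ◃ 1
  shifted-above {w} {a} {b} {s} o wa bw aw* ba* =
    trans (ω-out-in T.ε w a b) ([ w-between , [ b-between , a-between ] ]
      (some-between (T.Up⇒≢ bw ∘ sym) (T.Up⇒≢ wa) (T*.Up⇒≢ ba*)))
    where
    w-between : Between w b a → cyc T.ε w b a ≡ s ◃ 1
    -- In `T*` the reversed edge puts `w` above `a`, hence above the whole edge from `b` to `a`.
    w-between bt = trans (cyc-between T.ε bt (ε*≡ε w (T*.above-edge ba* bt (proj₂ aw*))))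
                         (cong (_◃ 1) (orientation bt))
      where
      orientation : (bt : Between w b a) → turn T.ε bt Sign.- ≡ s
      orientation (inj₁ (_ , w<a)) = sym (rightward o w<a)
      orientation (inj₂ (a<w , _)) = sym (leftward o a<w)
    b-between : Between b a w → cyc T.ε w b a ≡ s ◃ 1
    b-between bt = trans (cyc-rotate T.ε w b a)
      (trans (cyc-between T.ε bt (T.below-edge wa (Sum.swap bt) (proj₂ bw)))
             (cong (_◃ 1) (orientation bt)))
      where
      orientation : (bt : Between b a w) → turn T.ε bt Sign.+ ≡ s
      orientation (inj₁ (a<b , b<w)) = sym (leftward o (ℕ.<-trans a<b b<w))
      orientation (inj₂ (w<b , b<a)) = sym (rightward o (ℕ.<-trans w<b b<a))
    a-between : Between a w b → cyc T.ε w b a ≡ s ◃ 1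
    a-between bt = trans (sym (cyc-rotate T.ε a w b))
      (trans (cyc-between T.ε bt (T.above-edge bw (Sum.swap bt) (proj₂ wa)))
             (cong (_◃ 1) (orientation bt)))
      where
      orientation : (bt : Between a w b) → turn T.ε bt Sign.- ≡ s
      orientation (inj₁ (w<a , _)) = sym (rightward o w<a)
      orientation (inj₂ (_ , a<w)) = sym (leftward o a<w)

  -- The upside-down mirror image of `shifted-above`: each median has the opposite sign, and
  -- traversing `k` towards `w` instead of away from it restores `s`.
  shifted-below : ∀ {w a b s} → Oriented s a w → T.Up a w → T.Up w b → T*.Up w a → T*.Up a b →
                  ω (a , w) (w , b) ≡ s ◃ 1
  shifted-below {w} {a} {b} {s} o aw wb wa* ab* =
    trans (ω-in-out T.ε w a b) ([ w-between , [ b-between , a-between ] ]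
      (some-between (T.Up⇒≢ wb) (T.Up⇒≢ aw ∘ sym) (T*.Up⇒≢ ab* ∘ sym)))
    where
    w-between : Between w b a → cyc T.ε w b a ≡ s ◃ 1
    w-between bt = trans (cyc-between T.ε bt (ε*≡ε w (T*.below-edge ab* (Sum.swap bt) (proj₂ wa*))))
        (cong (_◃ 1) (orientation bt))
      where
      orientation : (bt : Between w b a) → turn T.ε bt Sign.+ ≡ s
      orientation (inj₁ (_ , w<a)) = sym (leftward o w<a)
      orientation (inj₂ (a<w , _)) = sym (rightward o a<w)
    b-between : Between b a w → cyc T.ε w b a ≡ s ◃ 1
    b-between bt = trans (cyc-rotate T.ε w b a) (trans (cyc-between T.ε bt (T.above-edge aw bt (proj₂ wb)))
        (cong (_◃ 1) (orientation bt)))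
      where
      orientation : (bt : Between b a w) → turn T.ε bt Sign.- ≡ s
      orientation (inj₁ (a<b , b<w)) = sym (rightward o (ℕ.<-trans a<b b<w))
      orientation (inj₂ (w<b , b<a)) = sym (leftward o (ℕ.<-trans w<b b<a))
    a-between : Between a w b → cyc T.ε w b a ≡ s ◃ 1
    a-between bt = trans (sym (cyc-rotate T.ε a w b))
      (trans (cyc-between T.ε bt (T.below-edge wb bt (proj₂ aw)))
             (cong (_◃ 1) (orientation bt)))
      where
      orientation : (bt : Between a w b) → turn T.ε bt Sign.+ ≡ s
      orientation (inj₁ (w<a , _)) = sym (leftward o w<a)
      orientation (inj₂ (_ , a<w)) = sym (rightward o a<w)

  shifted-arc : ∀ {s a b c d e f} → Oriented s a b → T.Up a b → T.Up c d → T*.Up b a → T*.Up e f →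
                (d ≡ a × e ≡ c × f ≡ b) ⊎ (b ≡ c × e ≡ a × f ≡ d) → ω (a , b) (c , d) ≡ s ◃ 1
  shifted-arc o ab cd ba* ef* (inj₁ (refl , refl , refl)) = shifted-above o ab cd ba* ef*
  shifted-arc o ab cd ba* ef* (inj₂ (refl , refl , refl)) = shifted-below o ab cd ba* ef*

  -- Two arcs kept at a common node lie on the same side of it, up or down, in T
  -- or in T*, so the wall at that node separates them.
  fixed-arc : ∀ {s a b c d} → Oriented s a b → T.Up a b → T.Up c d → T*.Up b a → T*.Up c d →
              ¬ (a ≡ c × b ≡ d) → ∃ λ r → ω (a , b) (c , d) ≡ opposite s ◃ r
  fixed-arc {s} {a} {b} {c} {d} o ab cd ba* cd* different
    with a Fin.≟ c | b Fin.≟ d | a Fin.≟ d | b Fin.≟ c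
  ... | yes refl | yes refl | _ | _ = contradiction (refl , refl) different
  ... | yes refl | no b≢d | _ | _ with T.up-up ab cd b≢d
  ...   | εₐ , bt = 1 , trans (ω-out-out T.ε a b d) (trans (cyc-between T.ε bt εₐ)
      (cong (_◃ 1) (orientation bt)))
    where
    orientation : (bt : Between a b d) → turn T.ε bt Sign.- ≡ opposite s
    orientation (inj₁ (b<a , _)) = cong opposite (sym (leftward o b<a))
    orientation (inj₂ (_ , a<b)) = cong opposite (sym (rightward o a<b))
  fixed-arc {s} {a} {b} {c} {d} o ab cd ba* cd* different
      | no a≢c | yes refl | _ | _ with T.down-down ab cd a≢c
  ...   | ε_b , bt = 1 , trans (ω-in-in T.ε b a c) (trans (cyc-between T.ε bt ε_b)
      (cong (_◃ 1) (orientation bt)))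
    where
    orientation : (bt : Between b a c) → turn T.ε bt Sign.+ ≡ opposite s
    orientation (inj₁ (a<b , _)) = cong opposite (sym (rightward o a<b))
    orientation (inj₂ (_ , b<a)) = cong opposite (sym (leftward o b<a))
  -- In `T` the edges rise from `c` through `a` to `b`; in `T*` both descend from `a`. If `b` and
  -- `c` coincided, the second edge would reverse the first in `T`.
  fixed-arc {s} {a} {b} {c} {d} o ab cd ba* cd* different
      | no _ | no _ | yes refl | _ with T*.down-down cd* ba* (λ { refl → T.Up-asym ab cd })
  ...   | εₐ , bt = 1 , trans (ω-out-in T.ε a b c) (trans (cyc-between T.ε bt (ε*≡ε a εₐ))
      (cong (_◃ 1) (orientation bt)))
    where
    orientation : (bt : Between a c b) → turn T.ε bt Sign.+ ≡ opposite s
    orientation (inj₁ (_ , a<b)) = cong opposite (sym (rightward o a<b))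
    orientation (inj₂ (b<a , _)) = cong opposite (sym (leftward o b<a))
  fixed-arc {s} {a} {b} {c} {d} o ab cd ba* cd* different
      | no _ | no _ | no a≢d | yes refl with T*.up-up cd* ba* (a≢d ∘ sym)
  ...   | ε_b , bt = 1 , trans (ω-in-out T.ε b a d) (trans (cyc-between T.ε bt (ε*≡ε b ε_b))
      (cong (_◃ 1) (orientation bt)))
    where
    orientation : (bt : Between b d a) → turn T.ε bt Sign.- ≡ opposite s
    orientation (inj₁ (_ , b<a)) = cong opposite (sym (leftward o b<a))
    orientation (inj₂ (a<b , _)) = cong opposite (sym (rightward o a<b))
  fixed-arc {s} {a} {b} {c} {d} o ab cd ba* cd* different
      | no a≢c | no b≢d | no a≢d | no b≢c =
    0 , T.ω-disjoint (proj₁ ab) (proj₁ cd) (T.Up⇒≢ ab) (T.Up⇒≢ cd) a≢c a≢d b≢c b≢d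

-- Verification of the mutation rule for every edge.

open import Data.Nat.Base using (_≤_)

theorem2 : ∀ {c ℓ₁ ℓ₂} (F : OrderedField c ℓ₁ ℓ₂) (n : ℕ) → 2 ≤ n →
    (ε : Vec Sign n) (T : MCT F n) → MCT.signVector T ≡ ε →
    (ℓ : EdgeNumbering T) (k : Fin (pred n)) →
    (T* : MCT F n) (ℓ* : EdgeNumbering T*) → IsMutation k ℓ ℓ* →
    ∀ i j → exchangeMatrix ℓ* i j ≡ mutate k (exchangeMatrix ℓ) i j
theorem2 F (ℕ.suc m) _ _ T _ ℓ k T* ℓ* μ =
  exchangeMatrix-mutates k ℓ ℓ* sameSigns c-k λ j j≢k → [ stays j≢k , moves ] (c-other j j≢k)
  where
  open IsMutation μ
  module T  = Rising T
  module T* = Rising T*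

  -- The functional determines the arc, so the negated c-vector means that edge `k` joins the same
  -- nodes in `T*` with opposite slope.
  reversed : T*.Up (proj₂ (arc ℓ k)) (proj₁ (arc ℓ k))
  reversed = subst T*.Rises
    (∂-injective (T*.Up⇒≢ (arc-rises ℓ* k))
      (λ G → trans (C-pairing-neg k ℓ ℓ* c-k G) (lemma (G (proj₁ (arc ℓ k))) (G (proj₂ (arc ℓ k))))))
    (arc-rises ℓ* k)
    where
    lemma : ∀ x y → - (x - y) ≡ y - x
    lemma = solve-∀

  -- An unchanged c-vector means an unchanged arc, which therefore rises in `T*` too; injectivity of
  -- the numbering keeps it different from `k`.
  stays : ∀ {j} → j ≢ k → (∀ r → C ℓ* r j ≡ C ℓ r j) → Change k ℓ ℓ* j
  stays {j} j≢k same = fixed same (proj₁ weak) (proj₂ weak)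
    where
    kept : T*.Rises (arc ℓ j)
    kept = subst T*.Rises (∂-injective (T*.Up⇒≢ (arc-rises ℓ* j)) (C-pairing-fixed k ℓ ℓ* same))
             (arc-rises ℓ* j)
    weak = fixed-arc {T = T} {T*} sameSigns (arc-oriented ℓ k) (arc-rises ℓ k) (arc-rises ℓ j) reversed kept
             (λ (tails , heads) → j≢k (sym (arc-injective ℓ (cong₂ _,_ tails heads))))

  -- The new edge `j` is the composite of the old `j` and `k`; the order of composition decides
  -- between `shifted-above` and `shifted-below`.
  moves : ∀ {j} → (∀ r → C ℓ* r j ≡ C ℓ r j + C ℓ r k) → Change k ℓ ℓ* j
  moves {j} moved = shifted moved
    (shifted-arc {T = T} {T*} sameSigns (arc-oriented ℓ k) (arc-rises ℓ k) (arc-rises ℓ j)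
      reversed (arc-rises ℓ* j)
      (∂-composite (T*.Up⇒≢ (arc-rises ℓ* j)) (T.Up⇒≢ (arc-rises ℓ j)) (T.Up⇒≢ (arc-rises ℓ k))
        (C-pairing-shifted k ℓ ℓ* moved)))
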